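{- For any integer $n\ge 0$, we have \[\mathrm{pod}_{ -3}(7n+3)\equiv (-1)^{n+1}r_3(8n+3) \pmod{7}.\]
   Context: $\mathrm{pod}_{ -3}(n)$ denotes the number of partition triples of $n$ in which the odd parts in each of the three partitions are distinct. Equivalently, as formal power series, \[\sum_{n=0}^{\infty}\mathrm{pod}_{ -3}(n)q^n=\frac{(-q;q^2)_\infty^3}{(q^2;q^2)_\infty^3}=\frac{1}{\psi(-q)^3},\] where $\psi(q)=\sum_{n=0}^{\infty}q^{n(n+1)/2}$ and $(a;q)_\infty=\prod_{k\ge 0}(1-aq^k)$. $r_k(n)$ denotes the number of representations of $n$ as a sum of $k$ squares, i.e. the number of $(x_1,\dots,x_k)\in\mathbb{Z}^k$ with $x_1^2+\cdots+x_k^2=n$. -}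

module Defs where

open import Data.Integer as ℤ using (ℤ; +_; -[1+_]; ∣_∣; 0ℤ)
open import Data.Integer.Properties using (+-injective; -[1+-injective)
open import Data.List
  using (List; []; _∷_; [_]; _++_; map; filter; length; upTo;
         cartesianProduct; cartesianProductWith)
open import Data.List.Membership.Propositional using (_∈_)
open import Data.List.Membership.Propositional.Properties
  using (∈-map⁺; ∈-map⁻; ∈-++⁺ˡ; ∈-++⁺ʳ; ∈-upTo⁺; ∈-filter⁺; ∈-filter⁻;
         ∈-cartesianProduct⁺; ∈-cartesianProductWith⁺; ∈-cartesianProductWith⁻)
open import Data.List.Properties using (∷-injective)
open import Data.List.Relation.Unary.All as All using (All; []; _∷_)
open import Data.List.Relation.Unary.AllPairs using ([]; _∷_)
open import Data.List.Relation.Unary.Any using (here; there)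
open import Data.List.Relation.Unary.Linked using (Linked; linked?)
open import Data.List.Relation.Unary.Unique.Propositional using (Unique)
import Data.List.Relation.Unary.Unique.Propositional.Properties as Uniqueₚ
open import Data.Nat
  using (ℕ; zero; suc; _+_; _*_; _≤_; _<_; _≥_; z≤n; s≤s; _≟_; _<?_; _≥?_)
open import Data.List.Relation.Unary.Unique.DecPropositional _≟_ using (unique?)
open import Data.Nat.ListAction using (sum)
open import Data.Nat.Divisibility using (_∣_; _∣?_)
open import Data.Nat.Properties
  using (≤-trans; ≤-reflexive; +-mono-≤; m≤m+n; m≤n+m; m≤m*n; suc-injective)
open import Data.Product using (_×_; _,_; proj₂)
open import Data.Vec as Vec using (Vec; []; _∷_)
import Data.Vec.Properties as Vecₚ
open import Function using (_⇔_; mk⇔)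
open import Relation.Binary.PropositionalEquality using (_≡_; refl; sym; trans; subst)
open import Relation.Nullary using (¬_)
open import Relation.Nullary.Decidable using (¬?; _×-dec_)
open import Relation.Unary using (Decidable)

Odd : ℕ → Set
Odd m = ¬ (2 ∣ m)

odd? : Decidable Odd
odd? m = ¬? (2 ∣? m)

-- A partition is the weakly decreasing list of its (positive) parts;
-- the number it partitions is the sum of the list.
IsPartition : List ℕ → Set
IsPartition xs = All (0 <_) xs × Linked _≥_ xs

OddPartsDistinct : List ℕ → Set
OddPartsDistinct xs = Unique (filter odd? xs)

IsPod : List ℕ → Set
IsPod xs = IsPartition xs × OddPartsDistinct xs

isPod? : Decidable IsPod
isPod? xs = (All.all? (0 <?_) xs ×-dec linked? _≥?_ xs) ×-dec unique? (filter odd? xs)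

Triple : Set
Triple = List ℕ × List ℕ × List ℕ

IsPodTriple : ℕ → Triple → Set
IsPodTriple n (xs , ys , zs) =
  sum xs + (sum ys + sum zs) ≡ n × IsPod xs × IsPod ys × IsPod zs

isPodTriple? : ∀ n → Decidable (IsPodTriple n)
isPodTriple? n (xs , ys , zs) =
  (sum xs + (sum ys + sum zs) ≟ n) ×-dec isPod? xs ×-dec isPod? ys ×-dec isPod? zs

listsOver : {A : Set} → ℕ → List A → List (List A)
listsOver zero    as = [ [] ]
listsOver (suc k) as = [] ∷ cartesianProductWith _∷_ as (listsOver k as)

vecsOver : {A : Set} (k : ℕ) → List A → List (Vec A k)
vecsOver zero    as = [ [] ]
vecsOver (suc k) as = cartesianProductWith _∷_ as (vecsOver k as)

-- The counts below filter a finite search space: a partition of a number at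
-- most n has at most n parts, each in {1, …, n}, and a coordinate in a
-- representation of n lies in {-n, …, n}.  podTriples-complete and
-- representations-complete show that no solution is missed; podTriples-unique
-- and representations-unique that none is counted twice.

boundedLists : ℕ → List (List ℕ)
boundedLists n = listsOver n (map suc (upTo n))

podTriples : ℕ → List Triple
podTriples n =
  filter (isPodTriple? n)
    (cartesianProduct (boundedLists n) (cartesianProduct (boundedLists n) (boundedLists n)))

pod₋₃ : ℕ → ℕ
pod₋₃ n = length (podTriples n)

sumOfSquares : ∀ {k} → Vec ℤ k → ℤ
sumOfSquares xs = Vec.foldr′ ℤ._+_ 0ℤ (Vec.map (λ x → x ℤ.* x) xs)

IsRepresentation : ∀ {k} → ℕ → Vec ℤ k → Set
IsRepresentation n xs = sumOfSquares xs ≡ + n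

interval : ℕ → List ℤ
interval n = map +_ (upTo (suc n)) ++ map -[1+_] (upTo n)

isRepresentation? : ∀ {k} n → Decidable (IsRepresentation {k} n)
isRepresentation? n xs = sumOfSquares xs ℤ.≟ + n

representations : (k n : ℕ) → List (Vec ℤ k)
representations k n =
  filter (isRepresentation? n) (vecsOver k (interval n))

r : ℕ → ℕ → ℕ
r k n = length (representations k n)

private
  listsOver-unique : ∀ {A : Set} k {as : List A} → Unique as → Unique (listsOver k as)
  listsOver-unique zero    u = [] ∷ []
  listsOver-unique (suc k) {as} u =
    All.tabulate (λ m e → nil∉ (subst (_∈ _) (sym e) m))
    ∷ Uniqueₚ.cartesianProductWith⁺ _∷_ ∷-injective u (listsOver-unique k u)
    where
    nil∉ : ¬ ([] ∈ cartesianProductWith _∷_ as (listsOver k as))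
    nil∉ m with ∈-cartesianProductWith⁻ _∷_ as (listsOver k as) m
    ... | _ , _ , _ , _ , ()

  vecsOver-unique : ∀ {A : Set} k {as : List A} → Unique as → Unique (vecsOver k as)
  vecsOver-unique zero    u = [] ∷ []
  vecsOver-unique (suc k) u =
    Uniqueₚ.cartesianProductWith⁺ _∷_ Vecₚ.∷-injective u (vecsOver-unique k u)

  interval-unique : ∀ n → Unique (interval n)
  interval-unique n =
    Uniqueₚ.++⁺ (Uniqueₚ.map⁺ +-injective (Uniqueₚ.upTo⁺ (suc n)))
                (Uniqueₚ.map⁺ -[1+-injective (Uniqueₚ.upTo⁺ n)) disjoint
    where
    disjoint : ∀ {v} → ¬ (v ∈ map +_ (upTo (suc n)) × v ∈ map -[1+_] (upTo n))
    disjoint (p , q) with ∈-map⁻ +_ p | ∈-map⁻ -[1+_] q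
    ... | _ , _ , refl | _ , _ , ()

  ∈-listsOver : ∀ {A : Set} k {as : List A} {xs} →
                All (_∈ as) xs → length xs ≤ k → xs ∈ listsOver k as
  ∈-listsOver zero    []       z≤n     = here refl
  ∈-listsOver (suc k) []       z≤n     = here refl
  ∈-listsOver (suc k) (m ∷ ms) (s≤s l) =
    there (∈-cartesianProductWith⁺ _∷_ m (∈-listsOver k ms l))

  length≤sum : ∀ {xs} → All (0 <_) xs → length xs ≤ sum xs
  length≤sum []       = z≤n
  length≤sum (p ∷ ps) = +-mono-≤ p (length≤sum ps)

  parts∈ : ∀ n {xs} → All (0 <_) xs → sum xs ≤ n → All (_∈ map suc (upTo n)) xs
  parts∈ n []                     _ = []
  parts∈ n {suc x ∷ xs} (p ∷ ps) s =
    ∈-map⁺ suc (∈-upTo⁺ (≤-trans (m≤m+n (suc x) (sum xs)) s))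
    ∷ parts∈ n ps (≤-trans (m≤n+m (sum xs) (suc x)) s)

  ∈-boundedLists : ∀ n {xs} → IsPod xs → sum xs ≤ n → xs ∈ boundedLists n
  ∈-boundedLists n ((pos , _) , _) s =
    ∈-listsOver n (parts∈ n pos s) (≤-trans (length≤sum pos) s)

  ∈-interval : ∀ n x → ∣ x ∣ ≤ n → x ∈ interval n
  ∈-interval n (+ x)    b = ∈-++⁺ˡ (∈-map⁺ +_ (∈-upTo⁺ (s≤s b)))
  ∈-interval n -[1+ x ] b = ∈-++⁺ʳ (map +_ (upTo (suc n))) (∈-map⁺ -[1+_] (∈-upTo⁺ b))

  absSquares : ∀ {k} → Vec ℤ k → ℕ
  absSquares []       = 0
  absSquares (x ∷ xs) = ∣ x ∣ * ∣ x ∣ + absSquares xs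

  square : ∀ x → x ℤ.* x ≡ + (∣ x ∣ * ∣ x ∣)
  square (+ zero)  = refl
  square (+ suc x) = refl
  square -[1+ x ]  = refl

  sumOfSquares-abs : ∀ {k} (xs : Vec ℤ k) → sumOfSquares xs ≡ + absSquares xs
  sumOfSquares-abs []       = refl
  sumOfSquares-abs (x ∷ xs) rewrite square x | sumOfSquares-abs xs = refl

  m≤m² : ∀ m → m ≤ m * m
  m≤m² zero    = z≤n
  m≤m² (suc m) = m≤m*n (suc m) (suc m)

  ∈-vecsOver : ∀ {k} n (xs : Vec ℤ k) → absSquares xs ≤ n → xs ∈ vecsOver k (interval n)
  ∈-vecsOver n []       _ = here refl
  ∈-vecsOver n (x ∷ xs) b = ∈-cartesianProductWith⁺ _∷_
    (∈-interval n x (≤-trans (m≤m² ∣ x ∣) (≤-trans (m≤m+n _ (absSquares xs)) b)))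
    (∈-vecsOver n xs (≤-trans (m≤n+m _ (∣ x ∣ * ∣ x ∣)) b))

podTriples-unique : ∀ n → Unique (podTriples n)
podTriples-unique n =
  Uniqueₚ.filter⁺ (isPodTriple? n)
    (Uniqueₚ.cartesianProduct⁺ u (Uniqueₚ.cartesianProduct⁺ u u))
  where
  u : Unique (boundedLists n)
  u = listsOver-unique n (Uniqueₚ.map⁺ suc-injective (Uniqueₚ.upTo⁺ n))

podTriples-complete : ∀ n t → t ∈ podTriples n ⇔ IsPodTriple n t
podTriples-complete n t@(xs , ys , zs) =
  mk⇔ (λ m → proj₂ (∈-filter⁻ (isPodTriple? n) {xs = space} m)) from
  where
  space : List Triple
  space = cartesianProduct (boundedLists n) (cartesianProduct (boundedLists n) (boundedLists n))
  from : IsPodTriple n t → t ∈ podTriples n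
  from h@(refl , px , py , pz) = ∈-filter⁺ (isPodTriple? n)
    (∈-cartesianProduct⁺ (∈-boundedLists n px (m≤m+n _ _))
      (∈-cartesianProduct⁺
        (∈-boundedLists n py (≤-trans (m≤m+n _ (sum zs)) (m≤n+m _ (sum xs))))
        (∈-boundedLists n pz (≤-trans (m≤n+m _ (sum ys)) (m≤n+m _ (sum xs)))))) h

representations-unique : ∀ k n → Unique (representations k n)
representations-unique k n =
  Uniqueₚ.filter⁺ (isRepresentation? n)
    (vecsOver-unique k (interval-unique n))

representations-complete : ∀ k n xs → xs ∈ representations k n ⇔ IsRepresentation n xs
representations-complete k n xs =
  mk⇔ (λ m → proj₂ (∈-filter⁻ (isRepresentation? n) {xs = vecsOver k (interval n)} m))
      (λ h → ∈-filter⁺ (isRepresentation? n) (∈-vecsOver n xs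
               (≤-reflexive (+-injective (trans (sym (sumOfSquares-abs xs)) h)))) h)

{-# OPTIONS --safe #-}
module Submission where

-- All series are taken up to X^N with N = 7n+3.  Let Ψ = ∑ X^(k(k+1)/2), and let P be the generating function
-- of pod partitions at -X; then P = 1/Ψ (Gauss), by Shanks' telescoping argument.  Modulo 7 the Frobenius gives
-- P³ = Ψ⁴/Ψ⁷ ≡ Ψ⁴/Ψ(X⁷).  By Jacobi Ψ⁴ = ∑ σ(2n+1) X^n, and σ(7k) ≡ σ(k), so extracting the exponents 7n+3
-- turns Ψ⁴ into itself and Ψ(X⁷) into Ψ: the coefficients of P³ there are those of Ψ⁴/Ψ = Ψ³.  Finally
-- r₃(8n+3) is 8 times the coefficient of X^n in Ψ³, because the three squares are all odd.
--
-- Jacobi's identity amounts to Ψ F′ = 4 Ψ′ F for F = ∑ σ(2n+1) X^n (then F/Ψ⁴ has derivative zero), that is,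
-- to ∑ d (de - x²) = 0 over the solutions of x² + 4de = 8i + 5 in odd numbers with d, e > 0.
-- This follows from involutions of the solution set in the style of Liouville and Zagier.

-- The class 7n+3 is singled out by 2(7n+3)+1 = 7(2n+1): at these exponents the divisor sums giving
-- Ψ⁴ are taken at multiples of 7. Writing the cube of 1/Ψ as Ψ⁴/Ψ⁷ separates a factor with
-- divisor-sum coefficients from one that modulo 7 is a series in X^7. The sign in the theorem is
-- the effect of replacing X by -X, since 7n+3 has the parity of n+1; the factor 8 of r₃ disappears
-- because 8 ≡ 1. Infinite products and sums of series are avoided: Ψ, F and P are finite sums of
-- monomials over duplicate-free lists, long enough for the exponents that are read, so their
-- identities hold only up to X^N. Division by Ψ is multiplication by P, and every change of
-- variables is a bijection between such lists. Jacobi's identity is proved exactly and reduced only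
-- afterwards: modulo 7 a zero derivative says nothing about the exponents divisible by 7.
-- Congruence modulo 0 lets the exact and the reduced computations share one calculus.

open import Defs
open import Data.Nat using (ℕ; _+_; _*_)
open import Data.Integer using (+_; -1ℤ; _-_; _^_) renaming (_*_ to _*ᶻ_)
open import Data.Integer.Divisibility using (_∣_)

open import Algebra.Bundles using (CommutativeRing)
import Algebra.Solver.Ring as RingSolver
open import Algebra.Solver.Ring.AlmostCommutativeRing using (fromCommutativeRing; _-Raw-AlmostCommutative⟶_)
open import Data.Integer as ℤ using (ℤ; 0ℤ; 1ℤ; -_; ∣_∣; -[1+_]; +≤+) renaming (_+_ to _+ᶻ_)
import Data.Integer.Properties as ℤₚ
open import Algebra.Properties.AbelianGroup ℤₚ.+-0-abelianGroup using (∙-cancelʳ)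
open import Data.Integer.Tactic.RingSolver using (solve-∀)
open import Data.List
  using (List; []; _∷_; [_]; _++_; map; filter; length; upTo; cartesianProduct)
open import Data.List.Membership.Propositional using (_∈_)
open import Data.List.Membership.Propositional.Properties
  using (∈-map⁺; ∈-map⁻; ∈-++⁺ˡ; ∈-++⁺ʳ; ∈-++⁻; ∈-upTo⁺; ∈-filter⁺; ∈-filter⁻;
         ∈-cartesianProduct⁺; ∈-cartesianProduct⁻)
open import Data.List.Membership.Propositional.Properties.WithK using (unique∧set⇒bag)
open import Data.List.Properties using (upTo-∷ʳ; filter-accept; filter-reject)
open import Data.List.Relation.Binary.BagAndSetEquality using (∼bag⇒↭)
open import Data.List.Relation.Binary.Permutation.Propositional using (_↭_; prep; swap)
  renaming (refl to ↭-refl; trans to ↭-trans)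
open import Data.List.Relation.Unary.All as All using (All; []; _∷_)
open import Data.List.Relation.Unary.AllPairs using ([]; _∷_)
open import Data.List.Relation.Unary.Any using (here; there)
open import Data.List.Relation.Unary.Linked using (Linked; []; [-]; _∷_)
open import Data.List.Relation.Unary.Linked.Properties using (Linked⇒All)
open import Data.List.Relation.Unary.Unique.Propositional using (Unique)
import Data.List.Relation.Unary.Unique.Propositional.Properties as Uniqueₚ
open import Data.Maybe as Maybe using (Maybe)
open import Data.Nat as ℕ using (zero; suc; _≤_; _<_; _≥_; z≤n; s≤s)
open import Data.Nat.DivMod using (_/_; m*n/n≡m)
open import Data.Nat.Divisibility as ℕDiv using (divides; _∣?_)
open import Data.Nat.ListAction using (sum)
open import Data.Nat.Primality using (prime?; euclidsLemma)
import Data.Nat.Properties as ℕₚ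
open import Data.Nat.Tactic.RingSolver using () renaming (solve-∀ to solveℕ-∀)
open import Data.Product using (_×_; _,_; proj₁; proj₂)
open import Data.Sum using (_⊎_; inj₁; inj₂)
open import Data.Vec using (Vec; []; _∷_)
open import Function using (_∘_; id; mk⇔; Equivalence)
open import Level using (0ℓ)
open import Relation.Binary.Bundles using (Setoid)
open import Relation.Binary.PropositionalEquality
  using (_≡_; _≢_; refl; sym; trans; cong; cong₂; subst; module ≡-Reasoning)
import Relation.Binary.Reasoning.Setoid as SetoidReasoning
open import Relation.Nullary using (¬_; yes; no; contradiction)
open import Relation.Nullary.Decidable using (¬?; dec⇒maybe; from-yes; from-no)
open import Relation.Unary using (Pred; Decidable)

-- Formal power series over ℤ

Series : Set
Series = ℕ → ℤ

infix 4 _≈_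
-- A record instead of a bare function type, so that the two series can be recovered from the type
-- of a proof.
record _≈_ (f g : Series) : Set where
  constructor pointwise
  field at : ∀ n → f n ≡ g n
open _≈_

infixl 6 _⊞_
infixl 7 _⊠_

shift : Series → Series
shift f n = f (suc n)

const : ℤ → Series
const z zero    = z
const z (suc _) = 0ℤ

_⊞_ : Series → Series → Series
(f ⊞ g) n = f n +ᶻ g n

⊟_ : Series → Series
(⊟ f) n = - f n

-- The Cauchy product through f = f 0 + X · `shift f`; proofs about it recurse on the index with f
-- left general.
_⊠_ : Series → Series → Series
(f ⊠ g) zero    = f 0 *ᶻ g 0
(f ⊠ g) (suc n) = f 0 *ᶻ g (suc n) +ᶻ (shift f ⊠ g) n

≈-setoid : Setoid _ _
≈-setoid = record
  { Carrier = Series ; _≈_ = _≈_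
  ; isEquivalence = record
    { refl  = pointwise λ _ → refl
    ; sym   = λ p → pointwise λ n → sym (at p n)
    ; trans = λ p q → pointwise λ n → trans (at p n) (at q n)
    }
  }

private
  ⊠-cong′ : ∀ {f f′ g g′} → (∀ n → f n ≡ f′ n) → (∀ n → g n ≡ g′ n) →
            ∀ n → (f ⊠ g) n ≡ (f′ ⊠ g′) n
  ⊠-cong′ p q zero    = cong₂ _*ᶻ_ (p 0) (q 0)
  ⊠-cong′ p q (suc n) =
    cong₂ _+ᶻ_ (cong₂ _*ᶻ_ (p 0) (q (suc n))) (⊠-cong′ (λ k → p (suc k)) q n)

  -- The defining recursion seen from the right factor, which is what commutativity needs.
  ⊠-suc : ∀ f g n → (f ⊠ g) (suc n) ≡ f (suc n) *ᶻ g 0 +ᶻ (f ⊠ shift g) n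
  ⊠-suc f g zero    = ℤₚ.+-comm (f 0 *ᶻ g 1) (f 1 *ᶻ g 0)
  ⊠-suc f g (suc n) rewrite ⊠-suc (shift f) g n =
    exchange (f 0 *ᶻ g (suc (suc n))) (f (suc (suc n)) *ᶻ g 0) ((shift f ⊠ shift g) n)
    where
    exchange : ∀ a b c → a +ᶻ (b +ᶻ c) ≡ b +ᶻ (a +ᶻ c)
    exchange = solve-∀

  ⊠-comm : ∀ f g n → (f ⊠ g) n ≡ (g ⊠ f) n
  ⊠-comm f g zero    = ℤₚ.*-comm (f 0) (g 0)
  ⊠-comm f g (suc n) = trans (cong₂ _+ᶻ_ (ℤₚ.*-comm (f 0) (g (suc n))) (⊠-comm (shift f) g n))
                             (sym (⊠-suc g f n))

  ⊠-distribʳ : ∀ h f g n → ((f ⊞ g) ⊠ h) n ≡ (f ⊠ h) n +ᶻ (g ⊠ h) n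
  ⊠-distribʳ h f g zero    = ℤₚ.*-distribʳ-+ (h 0) (f 0) (g 0)
  ⊠-distribʳ h f g (suc n) rewrite ⊠-distribʳ h (shift f) (shift g) n =
    regroup (f 0) (g 0) (h (suc n)) ((shift f ⊠ h) n) ((shift g ⊠ h) n)
    where
    regroup : ∀ a b c x y → (a +ᶻ b) *ᶻ c +ᶻ (x +ᶻ y) ≡ (a *ᶻ c +ᶻ x) +ᶻ (b *ᶻ c +ᶻ y)
    regroup = solve-∀

  scale-⊠ : ∀ c f g n → ((λ k → c *ᶻ f k) ⊠ g) n ≡ c *ᶻ (f ⊠ g) n
  scale-⊠ c f g zero    = ℤₚ.*-assoc c (f 0) (g 0)
  scale-⊠ c f g (suc n) rewrite scale-⊠ c (shift f) g n =
    factor c (f 0) (g (suc n)) ((shift f ⊠ g) n)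
    where
    factor : ∀ c a b x → c *ᶻ a *ᶻ b +ᶻ c *ᶻ x ≡ c *ᶻ (a *ᶻ b +ᶻ x)
    factor = solve-∀

  ⊠-assoc : ∀ f g h n → ((f ⊠ g) ⊠ h) n ≡ (f ⊠ (g ⊠ h)) n
  ⊠-assoc f g h zero    = ℤₚ.*-assoc (f 0) (g 0) (h 0)
  ⊠-assoc f g h (suc n) = begin
    f 0 *ᶻ g 0 *ᶻ h (suc n) +ᶻ (shift (f ⊠ g) ⊠ h) n
      ≡⟨ cong (f 0 *ᶻ g 0 *ᶻ h (suc n) +ᶻ_) (⊠-distribʳ h (λ k → f 0 *ᶻ g (suc k)) (shift f ⊠ g) n) ⟩
    f 0 *ᶻ g 0 *ᶻ h (suc n) +ᶻ (((λ k → f 0 *ᶻ g (suc k)) ⊠ h) n +ᶻ ((shift f ⊠ g) ⊠ h) n)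
      ≡⟨ cong (f 0 *ᶻ g 0 *ᶻ h (suc n) +ᶻ_)
           (cong₂ _+ᶻ_ (scale-⊠ (f 0) (shift g) h n) (⊠-assoc (shift f) g h n)) ⟩
    f 0 *ᶻ g 0 *ᶻ h (suc n) +ᶻ (f 0 *ᶻ (shift g ⊠ h) n +ᶻ (shift f ⊠ (g ⊠ h)) n)
      ≡⟨ regroup (f 0) (g 0) (h (suc n)) ((shift g ⊠ h) n) ((shift f ⊠ (g ⊠ h)) n) ⟩
    f 0 *ᶻ (g 0 *ᶻ h (suc n) +ᶻ (shift g ⊠ h) n) +ᶻ (shift f ⊠ (g ⊠ h)) n ∎
    where
    open ≡-Reasoning
    regroup : ∀ a b c x y → a *ᶻ b *ᶻ c +ᶻ (a *ᶻ x +ᶻ y) ≡ a *ᶻ (b *ᶻ c +ᶻ x) +ᶻ y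
    regroup = solve-∀

  zero-⊠ : ∀ g n → (const 0ℤ ⊠ g) n ≡ 0ℤ
  zero-⊠ g zero    = ℤₚ.*-zeroˡ (g 0)
  zero-⊠ g (suc n) = cong₂ _+ᶻ_ (ℤₚ.*-zeroˡ (g (suc n)))
    (trans (⊠-cong′ {g = g} (λ { zero → refl ; (suc _) → refl }) (λ _ → refl) n) (zero-⊠ g n))

shift-const : ∀ z → shift (const z) ≈ const 0ℤ
shift-const z = pointwise λ { zero → refl ; (suc _) → refl }

const-⊠ : ∀ z g n → (const z ⊠ g) n ≡ z *ᶻ g n
const-⊠ z g zero    = refl
const-⊠ z g (suc n) = trans
  (cong (z *ᶻ g (suc n) +ᶻ_) (trans (⊠-cong′ {g = g} (at (shift-const z)) (λ _ → refl) n) (zero-⊠ g n)))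
  (ℤₚ.+-identityʳ _)

seriesRing : CommutativeRing _ _
seriesRing = record
  { Carrier = Series ; _≈_ = _≈_ ; _+_ = _⊞_ ; _*_ = _⊠_ ; -_ = ⊟_
  ; 0# = const 0ℤ ; 1# = const 1ℤ
  ; isCommutativeRing = record
    { isRing = record
      { +-isAbelianGroup = record
        { isGroup = record
          { isMonoid = record
            { isSemigroup = record
              { isMagma = record
                { isEquivalence = Setoid.isEquivalence ≈-setoid
                ; ∙-cong = λ p q → pointwise λ n → cong₂ _+ᶻ_ (at p n) (at q n) }
              ; assoc = λ f g h → pointwise λ n → ℤₚ.+-assoc (f n) (g n) (h n) }
            ; identity = (λ f → pointwise λ n → trans (cong (_+ᶻ f n) (const-0 n)) (ℤₚ.+-identityˡ (f n)))
                       , (λ f → pointwise λ n → trans (cong (f n +ᶻ_) (const-0 n)) (ℤₚ.+-identityʳ (f n))) }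
          ; inverse = (λ f → pointwise λ n → trans (ℤₚ.+-inverseˡ (f n)) (sym (const-0 n)))
                    , (λ f → pointwise λ n → trans (ℤₚ.+-inverseʳ (f n)) (sym (const-0 n)))
          ; ⁻¹-cong = λ p → pointwise λ n → cong -_ (at p n) }
        ; comm = λ f g → pointwise λ n → ℤₚ.+-comm (f n) (g n) }
      ; *-cong = λ p q → pointwise (⊠-cong′ (at p) (at q))
      ; *-assoc = λ f g h → pointwise (⊠-assoc f g h)
      ; *-identity = (λ f → pointwise λ n → one-⊠ f n)
                   , (λ f → pointwise λ n → trans (⊠-comm f (const 1ℤ) n) (one-⊠ f n))
      ; distrib = (λ h f g → pointwise λ n → trans (⊠-comm h (f ⊞ g) n)
                    (trans (⊠-distribʳ h f g n) (cong₂ _+ᶻ_ (⊠-comm f h n) (⊠-comm g h n))))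
                , (λ h f g → pointwise (⊠-distribʳ h f g))
      }
    ; *-comm = λ f g → pointwise (⊠-comm f g)
    }
  }
  where
  const-0 : ∀ n → const 0ℤ n ≡ 0ℤ
  const-0 zero    = refl
  const-0 (suc _) = refl
  one-⊠ : ∀ f n → (const 1ℤ ⊠ f) n ≡ f n
  one-⊠ f n = trans (const-⊠ 1ℤ f n) (ℤₚ.*-identityˡ (f n))

module S = CommutativeRing seriesRing

-- Lets the solver compute with integer coefficients, whose equality is decidable while that of
-- series is not.
constants : ℤ.+-*-rawRing -Raw-AlmostCommutative⟶ fromCommutativeRing seriesRing
constants = record
  { ⟦_⟧    = const
  ; +-homo = λ a b → pointwise λ { zero → refl ; (suc _) → refl }
  ; *-homo = λ a b → pointwise λ n → sym (trans (const-⊠ a (const b) n) (scaled a b n))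
  ; -‿homo = λ a → pointwise λ { zero → refl ; (suc _) → refl }
  ; 0-homo = S.refl
  ; 1-homo = S.refl
  }
  where
  scaled : ∀ a b n → a *ᶻ const b n ≡ const (a *ᶻ b) n
  scaled a b zero    = refl
  scaled a b (suc _) = ℤₚ.*-zeroʳ a

const-≟ : ∀ a b → Maybe (const a ≈ const b)
const-≟ a b = Maybe.map (λ { refl → S.refl }) (dec⇒maybe (a ℤ.≟ b))

open RingSolver ℤ.+-*-rawRing (fromCommutativeRing seriesRing) constants const-≟
  using (solve; _:=_; _:+_; _:*_; :-_; _:^_; con)

-- For m = 0 the relation is equality (`~⇒≡`), so the exact identities and those modulo 7 are
-- instances of the same development.
module Congruence (m : ℤ) where

  infix 4 _~_

  record _~_ (a b : ℤ) : Set where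
    constructor _,_
    field
      quotient : ℤ
      equality : a ≡ b +ᶻ m *ᶻ quotient

  ~-refl : ∀ {a} → a ~ a
  ~-refl {a} = 0ℤ , lemma a m
    where
    lemma : ∀ a m → a ≡ a +ᶻ m *ᶻ 0ℤ
    lemma = solve-∀

  ~-sym : ∀ {a b} → a ~ b → b ~ a
  ~-sym {_} {b} (q , refl) = - q , lemma b m q
    where
    lemma : ∀ b m q → b ≡ b +ᶻ m *ᶻ q +ᶻ m *ᶻ - q
    lemma = solve-∀

  ~-trans : ∀ {a b c} → a ~ b → b ~ c → a ~ c
  ~-trans {c = c} (q , refl) (q′ , refl) = q′ +ᶻ q , lemma c m q q′
    where
    lemma : ∀ c m q q′ → c +ᶻ m *ᶻ q′ +ᶻ m *ᶻ q ≡ c +ᶻ m *ᶻ (q′ +ᶻ q)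
    lemma = solve-∀

  ~-reflexive : ∀ {a b} → a ≡ b → a ~ b
  ~-reflexive refl = ~-refl

  +-cong : ∀ {a b c d} → a ~ b → c ~ d → a +ᶻ c ~ b +ᶻ d
  +-cong {_} {b} {_} {d} (q , refl) (q′ , refl) = q +ᶻ q′ , lemma b d m q q′
    where
    lemma : ∀ b d m q q′ → b +ᶻ m *ᶻ q +ᶻ (d +ᶻ m *ᶻ q′) ≡ b +ᶻ d +ᶻ m *ᶻ (q +ᶻ q′)
    lemma = solve-∀

  neg-cong : ∀ {a b} → a ~ b → - a ~ - b
  neg-cong {_} {b} (q , refl) = - q , lemma b m q
    where
    lemma : ∀ b m q → - (b +ᶻ m *ᶻ q) ≡ - b +ᶻ m *ᶻ - q
    lemma = solve-∀

  *-cong : ∀ {a b c d} → a ~ b → c ~ d → a *ᶻ c ~ b *ᶻ d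
  *-cong {_} {b} {_} {d} (q , refl) (q′ , refl) = _ , lemma b d m q q′
    where
    lemma : ∀ b d m q q′ → (b +ᶻ m *ᶻ q) *ᶻ (d +ᶻ m *ᶻ q′) ≡
            b *ᶻ d +ᶻ m *ᶻ (b *ᶻ q′ +ᶻ q *ᶻ d +ᶻ m *ᶻ q *ᶻ q′)
    lemma = solve-∀

-- Congruence modulo m of the coefficients up to X^N

module Truncation (m : ℤ) (N : ℕ) where

  open Congruence m public

  infix 4 _≋_

  record _≋_ (f g : Series) : Set where
    constructor upTo-N
    field coeff : ∀ i → i ≤ N → f i ~ g i
  open _≋_ public

  ≈⇒≋ : ∀ {f g} → f ≈ g → f ≋ g
  ≈⇒≋ p = upTo-N λ i _ → ~-reflexive (at p i)

  ≋-setoid : Setoid _ _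
  ≋-setoid = record
    { Carrier = Series ; _≈_ = _≋_
    ; isEquivalence = record
      { refl  = upTo-N λ _ _ → ~-refl
      ; sym   = λ p → upTo-N λ i i≤N → ~-sym (coeff p i i≤N)
      ; trans = λ p q → upTo-N λ i i≤N → ~-trans (coeff p i i≤N) (coeff q i i≤N)
      }
    }
  open Setoid ≋-setoid public using ()
    renaming (refl to ≋-refl; sym to ≋-sym; trans to ≋-trans)

  ⊞-cong : ∀ {f f′ g g′} → f ≋ f′ → g ≋ g′ → f ⊞ g ≋ f′ ⊞ g′
  ⊞-cong p q = upTo-N λ i i≤N → +-cong (coeff p i i≤N) (coeff q i i≤N)

  -- The coefficient of X^i in a product involves only coefficients of index at most i, so
  -- truncation is compatible with multiplication.
  ⊠-cong : ∀ {f f′ g g′} → f ≋ f′ → g ≋ g′ → f ⊠ g ≋ f′ ⊠ g′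
  ⊠-cong {f} {f′} {g} {g′} p q = upTo-N λ i i≤N →
    go i f f′ (λ j j≤i → coeff p j (ℕₚ.≤-trans j≤i i≤N)) (λ j j≤i → coeff q j (ℕₚ.≤-trans j≤i i≤N))
    where
    go : ∀ i f f′ → (∀ j → j ≤ i → f j ~ f′ j) → (∀ j → j ≤ i → g j ~ g′ j) →
         (f ⊠ g) i ~ (f′ ⊠ g′) i
    go zero    f f′ p q = *-cong (p 0 z≤n) (q 0 z≤n)
    go (suc i) f f′ p q = +-cong (*-cong (p 0 z≤n) (q (suc i) ℕₚ.≤-refl))
      (go i (shift f) (shift f′) (λ j j≤i → p (suc j) (s≤s j≤i)) (λ j j≤i → q j (ℕₚ.m≤n⇒m≤1+n j≤i)))

  ⊠-congˡ : ∀ h {f g} → f ≋ g → h ⊠ f ≋ h ⊠ g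
  ⊠-congˡ h = ⊠-cong (≋-refl {h})

  ⊠-congʳ : ∀ h {f g} → f ≋ g → f ⊠ h ≋ g ⊠ h
  ⊠-congʳ h p = ⊠-cong p (≋-refl {h})

  ⊟-cong : ∀ {f g} → f ≋ g → ⊟ f ≋ ⊟ g
  ⊟-cong p = upTo-N λ i i≤N → neg-cong (coeff p i i≤N)

-- Monomials

δ : ℕ → Series
δ zero    n       = const 1ℤ n
δ (suc k) zero    = 0ℤ
δ (suc k) (suc n) = δ k n

δ-suc-⊠ : ∀ k f n → (δ (suc k) ⊠ f) (suc n) ≡ (δ k ⊠ f) n
δ-suc-⊠ k f n = trans (cong (_+ᶻ (δ k ⊠ f) n) (ℤₚ.*-zeroˡ (f (suc n)))) (ℤₚ.+-identityˡ _)

δ-⊠-+ : ∀ k f n → (δ k ⊠ f) (k + n) ≡ f n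
δ-⊠-+ zero    f n = at (S.*-identityˡ f) n
δ-⊠-+ (suc k) f n = trans (δ-suc-⊠ k f (k + n)) (δ-⊠-+ k f n)

δ-⊠-< : ∀ k f {n} → n < k → (δ k ⊠ f) n ≡ 0ℤ
δ-⊠-< (suc k) f {zero}  _         = ℤₚ.*-zeroˡ (f 0)
δ-⊠-< (suc k) f {suc n} (s≤s n<k) = trans (δ-suc-⊠ k f n) (δ-⊠-< k f n<k)

δ-+ : ∀ j k → δ (j + k) ≈ δ j ⊠ δ k
δ-+ zero    k = S.sym (S.*-identityˡ (δ k))
δ-+ (suc j) k = pointwise λ
  { zero    → sym (ℤₚ.*-zeroˡ (δ k 0))
  ; (suc n) → trans (at (δ-+ j k) n) (sym (δ-suc-⊠ j (δ k) n)) }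

δ-≡ : ∀ n → δ n n ≡ 1ℤ
δ-≡ zero    = refl
δ-≡ (suc n) = δ-≡ n

δ-≢ : ∀ {k n} → k ≢ n → δ k n ≡ 0ℤ
δ-≢ {zero}  {zero}  k≢n = contradiction refl k≢n
δ-≢ {zero}  {suc n} k≢n = refl
δ-≢ {suc k} {zero}  k≢n = refl
δ-≢ {suc k} {suc n} k≢n = δ-≢ {k} {n} λ { refl → k≢n refl }

-- Sums over lists

private variable
  A B : Set

∑ : List A → (A → ℤ) → ℤ
∑ []       f = 0ℤ
∑ (x ∷ xs) f = f x +ᶻ ∑ xs f

∑-cong-∈ : ∀ (xs : List A) {f g} → (∀ {x} → x ∈ xs → f x ≡ g x) → ∑ xs f ≡ ∑ xs g
∑-cong-∈ []       p = refl
∑-cong-∈ (x ∷ xs) p = cong₂ _+ᶻ_ (p (here refl)) (∑-cong-∈ xs (p ∘ there))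

∑-cong : ∀ (xs : List A) {f g} → (∀ x → f x ≡ g x) → ∑ xs f ≡ ∑ xs g
∑-cong xs p = ∑-cong-∈ xs λ {x} _ → p x

∑-+ : ∀ (xs : List A) f g → ∑ xs (λ x → f x +ᶻ g x) ≡ ∑ xs f +ᶻ ∑ xs g
∑-+ []       f g = refl
∑-+ (x ∷ xs) f g rewrite ∑-+ xs f g = interchange (f x) (g x) (∑ xs f) (∑ xs g)
  where
  interchange : ∀ a b c d → a +ᶻ b +ᶻ (c +ᶻ d) ≡ a +ᶻ c +ᶻ (b +ᶻ d)
  interchange = solve-∀

∑-* : ∀ c (xs : List A) f → ∑ xs (λ x → c *ᶻ f x) ≡ c *ᶻ ∑ xs f
∑-* c []       f = sym (ℤₚ.*-zeroʳ c)
∑-* c (x ∷ xs) f rewrite ∑-* c xs f = sym (ℤₚ.*-distribˡ-+ c (f x) (∑ xs f))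

∑-neg : ∀ (xs : List A) f → ∑ xs (λ x → - f x) ≡ - ∑ xs f
∑-neg []       f = refl
∑-neg (x ∷ xs) f rewrite ∑-neg xs f = sym (ℤₚ.neg-distrib-+ (f x) (∑ xs f))

∑-++ : ∀ (xs ys : List A) f → ∑ (xs ++ ys) f ≡ ∑ xs f +ᶻ ∑ ys f
∑-++ []       ys f = sym (ℤₚ.+-identityˡ _)
∑-++ (x ∷ xs) ys f rewrite ∑-++ xs ys f = sym (ℤₚ.+-assoc (f x) (∑ xs f) (∑ ys f))

∑-map : ∀ (h : A → B) xs f → ∑ (map h xs) f ≡ ∑ xs (f ∘ h)
∑-map h []       f = refl
∑-map h (x ∷ xs) f = cong (f (h x) +ᶻ_) (∑-map h xs f)

∑-1 : ∀ (xs : List A) → ∑ xs (λ _ → 1ℤ) ≡ + length xs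
∑-1 []       = refl
∑-1 (x ∷ xs) rewrite ∑-1 xs = refl

∑-↭ : ∀ {xs ys : List A} → xs ↭ ys → ∀ f → ∑ xs f ≡ ∑ ys f
∑-↭ ↭-refl        f = refl
∑-↭ (prep x p)    f = cong (f x +ᶻ_) (∑-↭ p f)
∑-↭ (swap {xs} {ys} x y p)  f rewrite ∑-↭ p f = exchange (f x) (f y) (∑ ys f)
  where
  exchange : ∀ a b c → a +ᶻ (b +ᶻ c) ≡ b +ᶻ (a +ᶻ c)
  exchange = solve-∀
∑-↭ (↭-trans p q) f = trans (∑-↭ p f) (∑-↭ q f)

∑-partition : ∀ {P : Pred A 0ℓ} (P? : Decidable P) xs f →
              ∑ xs f ≡ ∑ (filter P? xs) f +ᶻ ∑ (filter (¬? ∘ P?) xs) f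
∑-partition P? []       f = refl
∑-partition P? (x ∷ xs) f rewrite ∑-partition P? xs f with P? x
... | yes _ = sym (ℤₚ.+-assoc (f x) _ _)
... | no  _ = exchange (f x) (∑ (filter P? xs) f) (∑ (filter (¬? ∘ P?) xs) f)
  where
  exchange : ∀ a b c → a +ᶻ (b +ᶻ c) ≡ b +ᶻ (a +ᶻ c)
  exchange = solve-∀

module _ {xs : List A} {ys : List B} (xs! : Unique xs) (ys! : Unique ys)
         (to : A → B) (from : B → A)
         (to-∈ : ∀ {x} → x ∈ xs → to x ∈ ys × from (to x) ≡ x)
         (from-∈ : ∀ {y} → y ∈ ys → from y ∈ xs × to (from y) ≡ y) where

  private
    map-unique : ∀ {zs} → Unique zs → All (_∈ xs) zs → Unique (map to zs)
    map-unique []       []       = []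
    map-unique (z∉ ∷ u) (m ∷ ms) = All.tabulate distinct ∷ map-unique u ms
      where
      distinct : ∀ {w} → w ∈ map to _ → to _ ≢ w
      distinct w∈ e with ∈-map⁻ to w∈
      ... | v , v∈ , refl = All.lookup z∉ v∈
        (trans (sym (proj₂ (to-∈ m))) (trans (cong from e) (proj₂ (to-∈ (All.lookup ms v∈)))))

  -- `map to xs` has no duplicates because `from` inverts `to` on xs; two duplicate-free lists with
  -- the same elements are permutations of each other.
  ∑-reindex : ∀ f → ∑ xs (f ∘ to) ≡ ∑ ys f
  ∑-reindex f = trans (sym (∑-map to xs f)) (∑-↭ (∼bag⇒↭ (unique∧set⇒bag
    (map-unique xs! (All.tabulate id)) ys! (mk⇔ forth back))) f)
    where
    forth : ∀ {y} → y ∈ map to xs → y ∈ ys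
    forth y∈ with ∈-map⁻ to y∈
    ... | x , x∈ , refl = proj₁ (to-∈ x∈)
    back : ∀ {y} → y ∈ ys → y ∈ map to xs
    back y∈ = subst (_∈ map to xs) (proj₂ (from-∈ y∈)) (∈-map⁺ to (proj₁ (from-∈ y∈)))

-- Generating functions

-- Weight w and exponent e are kept as functions on the index list: products then become cartesian
-- products (`gf-⊠`), and coefficients become sums over filtered lists (`gf-coeff`).
gf : List A → (A → ℤ) → (A → ℕ) → Series
gf xs w e n = ∑ xs λ a → w a *ᶻ δ (e a) n

gf-coeff : ∀ (xs : List A) w e n → gf xs w e n ≡ ∑ (filter (λ a → e a ℕₚ.≟ n) xs) w
gf-coeff xs w e n = go xs λ a → e a ℕₚ.≟ n
  where
  go : ∀ xs (hit? : Decidable (λ a → e a ≡ n)) → gf xs w e n ≡ ∑ (filter hit? xs) w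
  go []       hit? = refl
  go (x ∷ xs) hit? with hit? x
  ... | yes refl = cong₂ _+ᶻ_ (trans (cong (w x *ᶻ_) (δ-≡ n)) (ℤₚ.*-identityʳ (w x))) (go xs hit?)
  ... | no  e≢n  = trans (cong₂ _+ᶻ_ (trans (cong (w x *ᶻ_) (δ-≢ e≢n)) (ℤₚ.*-zeroʳ (w x))) (go xs hit?))
                         (ℤₚ.+-identityˡ _)

gf-[] : ∀ (w : A → ℤ) e → gf [] w e ≈ const 0ℤ
gf-[] w e = pointwise λ { zero → refl ; (suc _) → refl }

gf-∷ : ∀ (x : A) xs w e → gf (x ∷ xs) w e ≈ const (w x) ⊠ δ (e x) ⊞ gf xs w e
gf-∷ x xs w e = pointwise λ n → cong (_+ᶻ gf xs w e n) (sym (const-⊠ (w x) (δ (e x)) n))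

gf-++ : ∀ (xs ys : List A) w e → gf (xs ++ ys) w e ≈ gf xs w e ⊞ gf ys w e
gf-++ xs ys w e = pointwise λ n → ∑-++ xs ys _

gf-map : ∀ (h : A → B) xs w e → gf (map h xs) w e ≈ gf xs (w ∘ h) (e ∘ h)
gf-map h xs w e = pointwise λ n → ∑-map h xs _

gf-scale : ∀ c k (xs : List A) w e →
           gf xs (λ a → c *ᶻ w a) (λ a → k + e a) ≈ (const c ⊠ δ k) ⊠ gf xs w e
gf-scale c k []       w e = S.trans (gf-[] (λ a → c *ᶻ w a) (λ a → k + e a))
  (S.trans (S.sym (S.zeroʳ (const c ⊠ δ k))) (S.*-congˡ {const c ⊠ δ k} (S.sym (gf-[] w e))))
gf-scale c k (x ∷ xs) w e = begin
  gf (x ∷ xs) (λ a → c *ᶻ w a) (λ a → k + e a)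
    ≈⟨ gf-∷ x xs (λ a → c *ᶻ w a) (λ a → k + e a) ⟩
  const (c *ᶻ w x) ⊠ δ (k + e x) ⊞ gf xs (λ a → c *ᶻ w a) (λ a → k + e a)
    ≈⟨ S.+-cong (S.*-cong (*-homo c (w x)) (δ-+ k (e x))) (gf-scale c k xs w e) ⟩
  (const c ⊠ const (w x)) ⊠ (δ k ⊠ δ (e x)) ⊞ (const c ⊠ δ k) ⊠ gf xs w e
    ≈⟨ solve 5 (λ c w k x r → (c :* w) :* (k :* x) :+ (c :* k) :* r := (c :* k) :* (w :* x :+ r))
         S.refl (const c) (const (w x)) (δ k) (δ (e x)) (gf xs w e) ⟩
  (const c ⊠ δ k) ⊠ (const (w x) ⊠ δ (e x) ⊞ gf xs w e)
    ≈⟨ S.*-congˡ {const c ⊠ δ k} (S.sym (gf-∷ x xs w e)) ⟩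
  (const c ⊠ δ k) ⊠ gf (x ∷ xs) w e ∎
  where
  open SetoidReasoning ≈-setoid
  open _-Raw-AlmostCommutative⟶_ constants using (*-homo)

gf-⊠ : ∀ (xs : List A) (ys : List B) v w d e →
       gf xs v d ⊠ gf ys w e ≈
       gf (cartesianProduct xs ys) (λ (a , b) → v a *ᶻ w b) (λ (a , b) → d a + e b)
gf-⊠ {A} {B} []       ys v w d e = S.trans (S.*-congʳ {gf ys w e} (gf-[] v d))
  (S.trans (S.zeroˡ (gf ys w e)) (S.sym (gf-[] {A = A × B} (λ (a , b) → v a *ᶻ w b) (λ (a , b) → d a + e b))))
gf-⊠ (x ∷ xs) ys v w d e = begin
  gf (x ∷ xs) v d ⊠ gf ys w e
    ≈⟨ S.*-congʳ {gf ys w e} (gf-∷ x xs v d) ⟩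
  (const (v x) ⊠ δ (d x) ⊞ gf xs v d) ⊠ gf ys w e
    ≈⟨ S.distribʳ (gf ys w e) (const (v x) ⊠ δ (d x)) (gf xs v d) ⟩
  const (v x) ⊠ δ (d x) ⊠ gf ys w e ⊞ gf xs v d ⊠ gf ys w e
    ≈⟨ S.+-cong (S.sym (S.trans (gf-map (x ,_) ys w′ e′) (gf-scale (v x) (d x) ys w e))) (gf-⊠ xs ys v w d e) ⟩
  gf (map (x ,_) ys) w′ e′ ⊞ gf (cartesianProduct xs ys) w′ e′
    ≈⟨ S.sym (gf-++ (map (x ,_) ys) (cartesianProduct xs ys) w′ e′) ⟩
  gf (cartesianProduct (x ∷ xs) ys) w′ e′ ∎
  where
  open SetoidReasoning ≈-setoid
  w′ = λ (a , b) → v a *ᶻ w b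
  e′ = λ (a , b) → d a + e b

gf-cong : ∀ (xs : List A) {v w d e} → (∀ a → v a ≡ w a) → (∀ a → d a ≡ e a) → gf xs v d ≈ gf xs w e
gf-cong xs p q = pointwise λ n → ∑-cong xs λ a → cong₂ (λ z k → z *ᶻ δ k n) (p a) (q a)

gf-constant : ∀ (xs : List A) w {a₀} → Unique xs → a₀ ∈ xs → ∀ e → e a₀ ≡ 0 →
              (∀ {a} → a ∈ xs → e a ≡ 0 → a ≡ a₀) → gf xs w e 0 ≡ w a₀
gf-constant xs w {a₀} xs! a₀∈ e e₀ only = begin
  gf xs w e 0           ≡⟨ gf-coeff xs w e 0 ⟩
  ∑ (filter zero? xs) w ≡⟨ sym (∑-reindex ([] ∷ []) (Uniqueₚ.filter⁺ zero? xs!) id id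
                                 (λ { (here refl) → ∈-filter⁺ zero? a₀∈ e₀ , refl }) back w) ⟩
  ∑ [ a₀ ] w            ≡⟨ ℤₚ.+-identityʳ (w a₀) ⟩
  w a₀                  ∎
  where
  open ≡-Reasoning
  zero? : Decidable (λ a → e a ≡ 0)
  zero? a = e a ℕₚ.≟ 0
  back : ∀ {a} → a ∈ filter zero? xs → a ∈ [ a₀ ] × a ≡ a
  back a∈ with ∈-filter⁻ zero? {xs = xs} a∈
  ... | a∈xs , e≡0 = here (only a∈xs e≡0) , refl

-- Triangular numbers

tri : ℕ → ℕ
tri zero    = 0
tri (suc k) = suc k + tri k

-- Recursive, so that `twice (suc s)` computes to two successors: each step of the enumeration of
-- pod partitions admits one odd and one even part size.
twice : ℕ → ℕ
twice zero    = 0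
twice (suc s) = suc (suc (twice s))

twice-≡ : ∀ s → twice s ≡ s + s
twice-≡ zero    = refl
twice-≡ (suc s) = cong suc (trans (cong suc (twice-≡ s)) (sym (ℕₚ.+-suc s s)))

twice-+ : ∀ s t → twice (s + t) ≡ twice s + twice t
twice-+ zero    t = refl
twice-+ (suc s) t = cong (λ k → suc (suc k)) (twice-+ s t)

tri-twice : ∀ n → tri (twice n) ≡ n * suc (twice n)
tri-twice zero    = refl
tri-twice (suc n) rewrite tri-twice n | twice-≡ n = lemma n
  where
  lemma : ∀ n → 2 + (n + n) + (1 + (n + n) + n * (1 + (n + n))) ≡ (1 + n) * (1 + (2 + (n + n)))
  lemma = solveℕ-∀

-- The partial sum with K terms; the terms left out have exponents at least `tri K`.
Ψ : ℕ → Series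
Ψ K = gf (upTo K) (λ _ → 1ℤ) tri

Ψ-suc : ∀ K → Ψ (suc K) ≈ Ψ K ⊞ δ (tri K)
Ψ-suc K = pointwise λ n → begin
  Ψ (suc K) n                     ≡⟨ cong (λ ks → ∑ ks (term n)) (sym (upTo-∷ʳ K)) ⟩
  ∑ (upTo K ++ [ K ]) (term n)    ≡⟨ ∑-++ (upTo K) [ K ] (term n) ⟩
  Ψ K n +ᶻ (term n K +ᶻ 0ℤ)       ≡⟨ cong (Ψ K n +ᶻ_) (trans (ℤₚ.+-identityʳ _) (ℤₚ.*-identityˡ _)) ⟩
  Ψ K n +ᶻ δ (tri K) n            ∎
  where
  open ≡-Reasoning
  term : ℕ → ℕ → ℤ
  term n k = 1ℤ *ᶻ δ (tri k) n

-- Pod partitions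

sgn : ℕ → ℤ
sgn k = -1ℤ ^ k

sgn-+ : ∀ j k → sgn (j + k) ≡ sgn j *ᶻ sgn k
sgn-+ = ℤₚ.^-distribˡ-+-* -1ℤ

sgn-twice : ∀ s → sgn (twice s) ≡ 1ℤ
sgn-twice zero    = refl
sgn-twice (suc s) rewrite sgn-twice s = refl

¬Odd-twice : ∀ s → ¬ Odd (twice s)
¬Odd-twice s odd = odd (divides s (trans (twice-≡ s) (lemma s)))
  where
  lemma : ∀ s → s + s ≡ s * 2
  lemma = solveℕ-∀

Odd-suc-twice : ∀ s → Odd (suc (twice s))
Odd-suc-twice s (divides q eq) = impossible s q (trans eq (trans (lemma q) (sym (twice-≡ q))))
  where
  lemma : ∀ s → s * 2 ≡ s + s
  lemma = solveℕ-∀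
  impossible : ∀ s q → suc (twice s) ≢ twice q
  impossible (suc s) (suc q) e = impossible s q (ℕₚ.suc-injective (ℕₚ.suc-injective e))

PodUpTo : ℕ → List ℕ → Set
PodUpTo c xs = IsPod xs × All (_≤ c) xs

private
  ∷-Linked : ∀ {c xs} → All (_≤ c) xs → Linked _≥_ xs → Linked _≥_ (c ∷ xs)
  ∷-Linked []      []  = [-]
  ∷-Linked (p ∷ _) l   = p ∷ l

  tail-Linked : ∀ {c xs} → Linked _≥_ (c ∷ xs) → Linked _≥_ xs
  tail-Linked [-]     = []
  tail-Linked (_ ∷ l) = l

  ≤-head : ∀ {c xs} → Linked _≥_ (c ∷ xs) → All (_≤ c) xs
  ≤-head [-]     = []
  ≤-head (p ∷ l) = Linked⇒All (λ i≥j j≥k → ℕₚ.≤-trans j≥k i≥j) p l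

PodUpTo-mono : ∀ {c xs} → PodUpTo c xs → PodUpTo (suc c) xs
PodUpTo-mono (pod , bound) = pod , All.map ℕₚ.m≤n⇒m≤1+n bound

-- An odd largest part occurs only once, so the bound on the remaining parts drops to c; for an even
-- one it stays at `suc c`. This dichotomy gives the factors 1 + q^k and 1/(1 - q^k).
PodUpTo-∷-odd⁺ : ∀ {c xs} → Odd (suc c) → PodUpTo c xs → PodUpTo (suc c) (suc c ∷ xs)
PodUpTo-∷-odd⁺ {c} {xs} odd (((pos , linked) , distinct) , bound) =
  ((s≤s z≤n ∷ pos , ∷-Linked bound′ linked) ,
   subst Unique (sym (filter-accept odd? {xs = xs} odd)) (All.tabulate fresh ∷ distinct)) ,
  ℕₚ.≤-refl ∷ bound′
  where
  bound′ : All (_≤ suc c) xs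
  bound′ = All.map ℕₚ.m≤n⇒m≤1+n bound
  fresh : ∀ {x} → x ∈ filter odd? xs → suc c ≢ x
  fresh x∈ refl = ℕₚ.<-irrefl refl (All.lookup bound (proj₁ (∈-filter⁻ odd? {xs = xs} x∈)))

PodUpTo-∷-odd⁻ : ∀ {c xs} → Odd (suc c) → IsPod (suc c ∷ xs) → PodUpTo c xs
PodUpTo-∷-odd⁻ {c} {xs} odd ((_ ∷ pos , linked) , distinct)
  with subst Unique (filter-accept odd? {xs = xs} odd) distinct
... | fresh ∷ distinct′ = ((pos , tail-Linked linked) , distinct′) , All.tabulate below
  where
  below : ∀ {x} → x ∈ xs → x ≤ c
  below {x} x∈ with ℕₚ.m≤n⇒m<n∨m≡n (All.lookup (≤-head linked) x∈)
  ... | inj₁ (s≤s x≤c) = x≤c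
  ... | inj₂ refl      = contradiction refl (All.lookup fresh (∈-filter⁺ odd? x∈ odd))

PodUpTo-∷-even⁺ : ∀ {c xs} → ¬ Odd (suc c) → PodUpTo (suc c) xs → PodUpTo (suc c) (suc c ∷ xs)
PodUpTo-∷-even⁺ {c} {xs} even (((pos , linked) , distinct) , bound) =
  ((s≤s z≤n ∷ pos , ∷-Linked bound linked) ,
   subst Unique (sym (filter-reject odd? {xs = xs} even)) distinct) ,
  ℕₚ.≤-refl ∷ bound

PodUpTo-∷-even⁻ : ∀ {c xs} → ¬ Odd c → IsPod (c ∷ xs) → PodUpTo c xs
PodUpTo-∷-even⁻ {c} {xs} even ((_ ∷ pos , linked) , distinct) =
  ((pos , tail-Linked linked) , subst Unique (filter-reject odd? {xs = xs} even) distinct) ,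
  ≤-head linked

PodUpTo-split : ∀ {c} x {xs} → PodUpTo (suc c) (x ∷ xs) → PodUpTo c (x ∷ xs) ⊎ x ≡ suc c
PodUpTo-split x (pod@((_ , linked) , _) , x≤ ∷ _) with ℕₚ.m≤n⇒m<n∨m≡n x≤
... | inj₁ (s≤s x≤c) = inj₁ (pod , x≤c ∷ All.map (λ y≤x → ℕₚ.≤-trans y≤x x≤c) (≤-head linked))
... | inj₂ x≡        = inj₂ x≡

PodUpTo-[] : ∀ {c} → PodUpTo c []
PodUpTo-[] = (([] , []) , []) , []

private
  unique-extend : ∀ {c} {xss yss : List (List ℕ)} → Unique xss → Unique yss →
                  (∀ {xs} → xs ∈ xss → All (_≤ c) xs) → Unique (xss ++ map (suc c ∷_) yss)
  unique-extend {c} {xss} {yss} xss! yss! bound =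
    Uniqueₚ.++⁺ xss! (Uniqueₚ.map⁺ (λ { refl → refl }) yss!) disjoint
    where
    disjoint : ∀ {v} → ¬ (v ∈ xss × v ∈ map (suc c ∷_) yss)
    disjoint (v∈ , v∈′) with ∈-map⁻ (suc c ∷_) v∈′
    ... | _ , _ , refl with bound v∈
    ... | c<c ∷ _ = ℕₚ.<-irrefl refl c<c

-- The sum 1 + X^k + ... + X^(jk) in Horner form, which is how `podsEven` builds its lists.
geometric : ℕ → ℕ → Series
geometric zero    k = const 1ℤ
geometric (suc j) k = const 1ℤ ⊞ δ k ⊠ geometric j k

geometric-⊠ : ∀ j k → geometric j k ⊠ (const 1ℤ ⊞ ⊟ δ k) ≈ const 1ℤ ⊞ ⊟ δ (suc j * k)
geometric-⊠ zero k = S.trans (S.*-identityˡ (const 1ℤ ⊞ ⊟ δ k))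
  (subst (λ i → const 1ℤ ⊞ ⊟ δ k ≈ const 1ℤ ⊞ ⊟ δ i) (sym (ℕₚ.+-identityʳ k)) S.refl)
geometric-⊠ (suc j) k = begin
  (const 1ℤ ⊞ δ k ⊠ geometric j k) ⊠ (const 1ℤ ⊞ ⊟ δ k)
    ≈⟨ solve 2 (λ x g → (con 1ℤ :+ x :* g) :* (con 1ℤ :+ :- x) :=
                        con 1ℤ :+ :- x :+ x :* (g :* (con 1ℤ :+ :- x)))
         S.refl (δ k) (geometric j k) ⟩
  const 1ℤ ⊞ ⊟ δ k ⊞ δ k ⊠ (geometric j k ⊠ (const 1ℤ ⊞ ⊟ δ k))
    ≈⟨ S.+-congˡ {const 1ℤ ⊞ ⊟ δ k} (S.*-congˡ {δ k} (geometric-⊠ j k)) ⟩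
  const 1ℤ ⊞ ⊟ δ k ⊞ δ k ⊠ (const 1ℤ ⊞ ⊟ δ (suc j * k))
    ≈⟨ solve 2 (λ x y → con 1ℤ :+ :- x :+ x :* (con 1ℤ :+ :- y) := con 1ℤ :+ :- (x :* y))
         S.refl (δ k) (δ (suc j * k)) ⟩
  const 1ℤ ⊞ ⊟ (δ k ⊠ δ (suc j * k))
    ≈⟨ S.+-congˡ {const 1ℤ} (S.-‿cong (S.sym (δ-+ k (suc j * k)))) ⟩
  const 1ℤ ⊞ ⊟ δ (suc (suc j) * k) ∎
  where open SetoidReasoning ≈-setoid

-- Enumeration of pod partitions by largest part

module Pods (N : ℕ) where

  open Truncation 0ℤ N

  -- pods s: parts at most 2s, with each even part occurring at most N times;
  -- podsEven s j: parts at most 2s+2, with the part 2s+2 occurring at most j times.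
  podsOdd pods : ℕ → List (List ℕ)
  podsEven     : ℕ → ℕ → List (List ℕ)
  podsOdd s          = pods s ++ map (suc (twice s) ∷_) (pods s)
  podsEven s zero    = podsOdd s
  podsEven s (suc j) = podsOdd s ++ map (twice (suc s) ∷_) (podsEven s j)
  pods zero    = [ [] ]
  pods (suc s) = podsEven s N

  pods-sound : ∀ s {xs} → xs ∈ pods s → PodUpTo (twice s) xs
  podsOdd-sound : ∀ s {xs} → xs ∈ podsOdd s → PodUpTo (suc (twice s)) xs
  podsEven-sound : ∀ s j {xs} → xs ∈ podsEven s j → PodUpTo (twice (suc s)) xs
  pods-sound zero    (here refl) = PodUpTo-[]
  pods-sound (suc s) xs∈         = podsEven-sound s N xs∈
  podsOdd-sound s xs∈ with ∈-++⁻ (pods s) xs∈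
  ... | inj₁ xs∈ = PodUpTo-mono (pods-sound s xs∈)
  ... | inj₂ xs∈ with ∈-map⁻ (suc (twice s) ∷_) xs∈
  ... | _ , ys∈ , refl = PodUpTo-∷-odd⁺ (Odd-suc-twice s) (pods-sound s ys∈)
  podsEven-sound s zero    xs∈ = PodUpTo-mono (podsOdd-sound s xs∈)
  podsEven-sound s (suc j) xs∈ with ∈-++⁻ (podsOdd s) xs∈
  ... | inj₁ xs∈ = PodUpTo-mono (podsOdd-sound s xs∈)
  ... | inj₂ xs∈ with ∈-map⁻ (twice (suc s) ∷_) xs∈
  ... | _ , ys∈ , refl = PodUpTo-∷-even⁺ (¬Odd-twice (suc s)) (podsEven-sound s j ys∈)

  pods-complete : ∀ s {xs} → PodUpTo (twice s) xs → sum xs ≤ N → xs ∈ pods s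
  podsOdd-complete : ∀ s {xs} → PodUpTo (suc (twice s)) xs → sum xs ≤ N → xs ∈ podsOdd s
  -- The cap j on the number of copies loses nothing when the sum is at most j: each copy removed
  -- lowers the sum by at least 1, so the bound passes to j - 1.
  podsEven-complete : ∀ s j {xs} → PodUpTo (twice (suc s)) xs → sum xs ≤ N → sum xs ≤ j →
                      xs ∈ podsEven s j
  pods-complete zero {[]}    _ _ = here refl
  pods-complete zero {x ∷ _} (((0<x ∷ _ , _) , _) , x≤0 ∷ _) _ =
    contradiction (ℕₚ.<-≤-trans 0<x x≤0) λ ()
  pods-complete (suc s) p sum≤N = podsEven-complete s N p sum≤N sum≤N
  podsOdd-complete s {[]} _ sum≤N = ∈-++⁺ˡ (pods-complete s PodUpTo-[] sum≤N)
  podsOdd-complete s {x ∷ xs} p sum≤N with PodUpTo-split x p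
  ... | inj₁ q    = ∈-++⁺ˡ (pods-complete s q sum≤N)
  ... | inj₂ refl = ∈-++⁺ʳ (pods s) (∈-map⁺ (suc (twice s) ∷_)
    (pods-complete s (PodUpTo-∷-odd⁻ (Odd-suc-twice s) (proj₁ p)) (ℕₚ.m+n≤o⇒n≤o x sum≤N)))
  podsEven-complete s zero    {[]} _ sum≤N _ = podsOdd-complete s PodUpTo-[] sum≤N
  podsEven-complete s (suc j) {[]} _ sum≤N _ = ∈-++⁺ˡ (podsOdd-complete s PodUpTo-[] sum≤N)
  podsEven-complete s zero    {x ∷ xs} (((0<x ∷ _ , _) , _) , _) _ sum≤0 =
    contradiction (ℕₚ.<-≤-trans 0<x (ℕₚ.m+n≤o⇒m≤o x sum≤0)) λ ()
  podsEven-complete s (suc j) {x ∷ xs} p sum≤N sum≤j with PodUpTo-split x p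
  ... | inj₁ q    = ∈-++⁺ˡ (podsOdd-complete s q sum≤N)
  ... | inj₂ refl = ∈-++⁺ʳ (podsOdd s) (∈-map⁺ (twice (suc s) ∷_)
    (podsEven-complete s j (PodUpTo-∷-even⁻ (¬Odd-twice (suc s)) (proj₁ p))
      (ℕₚ.m+n≤o⇒n≤o x sum≤N)
      (ℕₚ.m+n≤o⇒n≤o (suc (twice s)) (ℕₚ.≤-pred sum≤j))))

  pods-unique : ∀ s → Unique (pods s)
  podsOdd-unique : ∀ s → Unique (podsOdd s)
  podsEven-unique : ∀ s j → Unique (podsEven s j)
  pods-unique zero    = [] ∷ []
  pods-unique (suc s) = podsEven-unique s N
  podsOdd-unique s = unique-extend (pods-unique s) (pods-unique s) (λ xs∈ → proj₂ (pods-sound s xs∈))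
  podsEven-unique s zero    = podsOdd-unique s
  podsEven-unique s (suc j) = unique-extend (podsOdd-unique s) (podsEven-unique s j)
    (λ xs∈ → proj₂ (podsOdd-sound s xs∈))

  -- Counting at -X turns 1/ψ(-q) into 1/ψ(X).
  signed : List (List ℕ) → Series
  signed xss = gf xss (λ xs → sgn (sum xs)) sum

  signed-∷ : ∀ c xss → signed (map (c ∷_) xss) ≈ (const (sgn c) ⊠ δ c) ⊠ signed xss
  signed-∷ c xss = S.trans (gf-map (c ∷_) xss (λ xs → sgn (sum xs)) sum)
    (S.trans (gf-cong xss {d = λ xs → c + sum xs} (λ xs → sgn-+ c (sum xs)) (λ _ → refl))
      (gf-scale (sgn c) c xss (λ xs → sgn (sum xs)) sum))

  -- Up to X^N this is the product of (1 - X^(2j-1))/(1 - X^(2j)) over 1 ≤ j ≤ s; `P-suc` is its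
  -- recursion, cleared of denominators.
  P : ℕ → Series
  P s = signed (pods s)

  signed-podsOdd : ∀ s → signed (podsOdd s) ≈ P s ⊠ (const 1ℤ ⊞ ⊟ δ (suc (twice s)))
  signed-podsOdd s = begin
    signed (podsOdd s)
      ≈⟨ gf-++ (pods s) (map (suc (twice s) ∷_) (pods s)) (λ xs → sgn (sum xs)) sum ⟩
    P s ⊞ signed (map (suc (twice s) ∷_) (pods s))
      ≈⟨ S.+-congˡ {P s} (signed-∷ (suc (twice s)) (pods s)) ⟩
    P s ⊞ (const (sgn (suc (twice s))) ⊠ δ (suc (twice s))) ⊠ P s
      ≡⟨ cong (λ z → P s ⊞ (const z ⊠ δ (suc (twice s))) ⊠ P s) (cong (-1ℤ *ᶻ_) (sgn-twice s)) ⟩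
    P s ⊞ (const -1ℤ ⊠ δ (suc (twice s))) ⊠ P s
      ≈⟨ solve 2 (λ p x → p :+ (con -1ℤ :* x) :* p := p :* (con 1ℤ :+ :- x))
           S.refl (P s) (δ (suc (twice s))) ⟩
    P s ⊠ (const 1ℤ ⊞ ⊟ δ (suc (twice s))) ∎
    where open SetoidReasoning ≈-setoid

  signed-podsEven : ∀ s j → signed (podsEven s j) ≈ geometric j (twice (suc s)) ⊠ signed (podsOdd s)
  signed-podsEven s zero    = S.sym (S.*-identityˡ (signed (podsOdd s)))
  signed-podsEven s (suc j) = begin
    signed (podsEven s (suc j))
      ≈⟨ gf-++ (podsOdd s) (map (c ∷_) (podsEven s j)) (λ xs → sgn (sum xs)) sum ⟩
    o ⊞ signed (map (c ∷_) (podsEven s j))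
      ≈⟨ S.+-congˡ {o} (signed-∷ c (podsEven s j)) ⟩
    o ⊞ (const (sgn c) ⊠ δ c) ⊠ signed (podsEven s j)
      ≈⟨ S.+-congˡ {o} (S.*-cong (subst (λ z → const (sgn c) ⊠ δ c ≈ const z ⊠ δ c) (sgn-twice (suc s)) S.refl)
           (signed-podsEven s j)) ⟩
    o ⊞ (const 1ℤ ⊠ δ c) ⊠ (geometric j c ⊠ o)
      ≈⟨ solve 3 (λ o x g → o :+ (con 1ℤ :* x) :* (g :* o) := (con 1ℤ :+ x :* g) :* o)
           S.refl o (δ c) (geometric j c) ⟩
    geometric (suc j) c ⊠ o ∎
    where
    open SetoidReasoning ≈-setoid
    c = twice (suc s)
    o = signed (podsOdd s)

  δ-≋-0 : ∀ {k} → N < k → ∀ f → δ k ⊠ f ≋ const 0ℤ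
  δ-≋-0 {k} N<k f = upTo-N λ
    { zero    i≤N → ~-reflexive (δ-⊠-< k f (ℕₚ.≤-<-trans i≤N N<k))
    ; (suc i) i≤N → ~-reflexive (δ-⊠-< k f (ℕₚ.≤-<-trans i≤N N<k)) }

  1-δ-inverse : ∀ k → geometric N (suc k) ⊠ (const 1ℤ ⊞ ⊟ δ (suc k)) ≋ const 1ℤ
  1-δ-inverse k = begin
    geometric N (suc k) ⊠ (const 1ℤ ⊞ ⊟ δ (suc k))  ≈⟨ ≈⇒≋ (geometric-⊠ N (suc k)) ⟩
    const 1ℤ ⊞ ⊟ x                                  ≈⟨ ≈⇒≋ (solve 1 (λ x → con 1ℤ :+ :- x := con 1ℤ :+ :- (x :* con 1ℤ)) S.refl x) ⟩
    -- The leftover monomial has exponent (N+1)(k+1) > N and is cut off.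
    const 1ℤ ⊞ ⊟ (x ⊠ const 1ℤ)                     ≈⟨ ⊞-cong (≋-refl {const 1ℤ}) (⊟-cong (δ-≋-0 (ℕₚ.m≤m*n (suc N) (suc k)) (const 1ℤ))) ⟩
    const 1ℤ ⊞ ⊟ const 0ℤ                           ≈⟨ ≈⇒≋ (solve 0 (con 1ℤ :+ :- con 0ℤ := con 1ℤ) S.refl) ⟩
    const 1ℤ                                        ∎
    where
    open SetoidReasoning ≋-setoid
    x = δ (suc N * suc k)

  1-δ-cancel : ∀ k f g → (const 1ℤ ⊞ ⊟ δ (suc k)) ⊠ f ≋ (const 1ℤ ⊞ ⊟ δ (suc k)) ⊠ g → f ≋ g
  1-δ-cancel k f g p = ≋-trans (≋-sym (regroup f)) (≋-trans (⊠-congˡ (geometric N (suc k)) p) (regroup g))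
    where
    regroup : ∀ h → geometric N (suc k) ⊠ ((const 1ℤ ⊞ ⊟ δ (suc k)) ⊠ h) ≋ h
    regroup h = ≋-trans (≈⇒≋ (S.sym (S.*-assoc (geometric N (suc k)) (const 1ℤ ⊞ ⊟ δ (suc k)) h)))
      (≋-trans (⊠-congʳ h (1-δ-inverse k)) (≈⇒≋ (S.*-identityˡ h)))

  P-suc : ∀ s → P (suc s) ⊠ (const 1ℤ ⊞ ⊟ δ (twice (suc s))) ≋ P s ⊠ (const 1ℤ ⊞ ⊟ δ (suc (twice s)))
  P-suc s = begin
    P (suc s) ⊠ d                             ≈⟨ ≈⇒≋ (S.*-congʳ {d} (signed-podsEven s N)) ⟩
    g ⊠ signed (podsOdd s) ⊠ d                ≈⟨ ≈⇒≋ (solve 3 (λ g o d → g :* o :* d := g :* d :* o) S.refl g (signed (podsOdd s)) d) ⟩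
    g ⊠ d ⊠ signed (podsOdd s)                ≈⟨ ⊠-congʳ (signed (podsOdd s)) (1-δ-inverse (suc (twice s))) ⟩
    const 1ℤ ⊠ signed (podsOdd s)             ≈⟨ ≈⇒≋ (S.*-identityˡ (signed (podsOdd s))) ⟩
    signed (podsOdd s)                        ≈⟨ ≈⇒≋ (signed-podsOdd s) ⟩
    P s ⊠ (const 1ℤ ⊞ ⊟ δ (suc (twice s)))    ∎
    where
    open SetoidReasoning ≋-setoid
    d = const 1ℤ ⊞ ⊟ δ (twice (suc s))
    g = geometric N (twice (suc s))

-- Gauss's identity: P is inverse to Ψ

module Gauss (N : ℕ) where

  open Truncation 0ℤ N
  open Pods N

  -- The sum of P s · X^(se) over s < m, evaluated in two ways: for e = 2n+1 and m = n it equals P n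
  -- times a partial sum of Ψ (`partial-Ψ`), and for e > N only its first term 1 survives
  -- (`partial-1`).
  partial : ℕ → ℕ → Series
  partial e zero    = const 0ℤ
  partial e (suc m) = partial e m ⊞ P m ⊠ δ (m * e)

  -- Shanks' telescoping identity; his partial products P_n are the inverses of P here.
  telescope : ∀ n m →
    (const 1ℤ ⊞ ⊟ δ (twice (suc n))) ⊠ partial (suc (twice (suc n))) (suc m) ≋
    (const 1ℤ ⊞ ⊟ δ (suc (twice n))) ⊠ partial (suc (twice n)) m
      ⊞ P m ⊠ δ (m * suc (twice n)) ⊠ (const 1ℤ ⊞ ⊟ δ (twice (m + suc n)))
  telescope n zero = ≈⇒≋ (solve 3 (λ x y p →
    (con 1ℤ :+ :- x) :* (con 0ℤ :+ p :* con 1ℤ) :=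
    (con 1ℤ :+ :- y) :* con 0ℤ :+ p :* con 1ℤ :* (con 1ℤ :+ :- x))
    S.refl (δ (twice (suc n))) (δ (suc (twice n))) (P 0))
  telescope n (suc m) = begin
    (const 1ℤ ⊞ ⊟ xu) ⊠ (L ⊞ Pₘ₊₁ ⊠ q)
      ≈⟨ ≈⇒≋ (solve 4 (λ c l a q → c :* (l :+ a :* q) := c :* l :+ c :* (a :* q)) S.refl (const 1ℤ ⊞ ⊟ xu) L Pₘ₊₁ q) ⟩
    (const 1ℤ ⊞ ⊟ xu) ⊠ L ⊞ (const 1ℤ ⊞ ⊟ xu) ⊠ (Pₘ₊₁ ⊠ q)
      ≈⟨ ⊞-cong (telescope n m) (≋-refl {(const 1ℤ ⊞ ⊟ xu) ⊠ (Pₘ₊₁ ⊠ q)}) ⟩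
    (const 1ℤ ⊞ ⊟ u) ⊠ R ⊞ Pₘ ⊠ p ⊠ (const 1ℤ ⊞ ⊟ w) ⊞ (const 1ℤ ⊞ ⊟ xu) ⊠ (Pₘ₊₁ ⊠ q)
      ≈⟨ ≈⇒≋ (S.+-cong (S.+-congˡ {(const 1ℤ ⊞ ⊟ u) ⊠ R} (S.*-congˡ {Pₘ ⊠ p} (one-minus w-≈)))
                        (S.*-cong (one-minus xu-≈) (S.*-congˡ {Pₘ₊₁} q-≈))) ⟩
    (const 1ℤ ⊞ ⊟ u) ⊠ R ⊞ Pₘ ⊠ p ⊠ (const 1ℤ ⊞ ⊟ (v ⊠ (x ⊠ u)))
      ⊞ (const 1ℤ ⊞ ⊟ (x ⊠ u)) ⊠ (Pₘ₊₁ ⊠ (p ⊠ (u ⊠ (v ⊠ (x ⊠ x)))))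
      -- Here 1 - vxu = (1 - u) + u(1 - xv). The first summand extends R by its next term; the
      -- second produces the numerator 1 - X^(2m+1) by which P m passes to P (m+1).
      ≈⟨ ≈⇒≋ (solve 7 (λ r a a′ p u v x →
           (con 1ℤ :+ :- u) :* r :+ a :* p :* (con 1ℤ :+ :- (v :* (x :* u)))
             :+ (con 1ℤ :+ :- (x :* u)) :* (a′ :* (p :* (u :* (v :* (x :* x))))) :=
           (con 1ℤ :+ :- u) :* (r :+ a :* p) :+ p :* u :* (a :* (con 1ℤ :+ :- (x :* v)))
             :+ (con 1ℤ :+ :- (x :* u)) :* (a′ :* (p :* (u :* (v :* (x :* x))))))
           S.refl R Pₘ Pₘ₊₁ p u v x) ⟩
    (const 1ℤ ⊞ ⊟ u) ⊠ (R ⊞ Pₘ ⊠ p) ⊞ p ⊠ u ⊠ (Pₘ ⊠ (const 1ℤ ⊞ ⊟ (x ⊠ v)))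
      ⊞ (const 1ℤ ⊞ ⊟ (x ⊠ u)) ⊠ (Pₘ₊₁ ⊠ (p ⊠ (u ⊠ (v ⊠ (x ⊠ x)))))
      ≈⟨ ⊞-cong (⊞-cong (≋-refl {(const 1ℤ ⊞ ⊟ u) ⊠ (R ⊞ Pₘ ⊠ p)}) (⊠-congˡ (p ⊠ u) ratio))
                (≋-refl {(const 1ℤ ⊞ ⊟ (x ⊠ u)) ⊠ (Pₘ₊₁ ⊠ (p ⊠ (u ⊠ (v ⊠ (x ⊠ x)))))}) ⟩
    (const 1ℤ ⊞ ⊟ u) ⊠ (R ⊞ Pₘ ⊠ p) ⊞ p ⊠ u ⊠ (Pₘ₊₁ ⊠ (const 1ℤ ⊞ ⊟ (x ⊠ (x ⊠ v))))
      ⊞ (const 1ℤ ⊞ ⊟ (x ⊠ u)) ⊠ (Pₘ₊₁ ⊠ (p ⊠ (u ⊠ (v ⊠ (x ⊠ x)))))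
      -- The terms x²v cancel, leaving 1 - x³uv with x³uv = X^(2(m+n+2)).
      ≈⟨ ≈⇒≋ (solve 7 (λ r a a′ p u v x →
           (con 1ℤ :+ :- u) :* (r :+ a :* p) :+ p :* u :* (a′ :* (con 1ℤ :+ :- (x :* (x :* v))))
             :+ (con 1ℤ :+ :- (x :* u)) :* (a′ :* (p :* (u :* (v :* (x :* x))))) :=
           (con 1ℤ :+ :- u) :* (r :+ a :* p) :+ a′ :* (u :* p) :* (con 1ℤ :+ :- (x :* (x :* (v :* (x :* u))))))
           S.refl R Pₘ Pₘ₊₁ p u v x) ⟩
    (const 1ℤ ⊞ ⊟ u) ⊠ (R ⊞ Pₘ ⊠ p) ⊞ Pₘ₊₁ ⊠ (u ⊠ p) ⊠ (const 1ℤ ⊞ ⊟ (x ⊠ (x ⊠ (v ⊠ (x ⊠ u)))))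
      ≈⟨ ≈⇒≋ (S.sym (S.+-congˡ {(const 1ℤ ⊞ ⊟ u) ⊠ (R ⊞ Pₘ ⊠ p)}
           (S.*-cong (S.*-congˡ {Pₘ₊₁} (δ-+ (suc (twice n)) (m * suc (twice n)))) (one-minus w′-≈)))) ⟩
    (const 1ℤ ⊞ ⊟ u) ⊠ (R ⊞ Pₘ ⊠ p) ⊞ Pₘ₊₁ ⊠ δ (suc m * suc (twice n)) ⊠ (const 1ℤ ⊞ ⊟ δ (twice (suc m + suc n))) ∎
    where
    open SetoidReasoning ≋-setoid
    Pₘ   = P m
    Pₘ₊₁ = P (suc m)
    x  = δ 1
    u  = δ (suc (twice n))
    xu = δ (twice (suc n))
    v  = δ (twice m)
    p  = δ (m * suc (twice n))
    q  = δ (suc m * suc (twice (suc n)))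
    w  = δ (twice (m + suc n))
    L  = partial (suc (twice (suc n))) (suc m)
    R  = partial (suc (twice n)) m
    one-minus : ∀ {f g} → f ≈ g → const 1ℤ ⊞ ⊟ f ≈ const 1ℤ ⊞ ⊟ g
    one-minus {f} {g} f≈g = S.+-congˡ {const 1ℤ} {⊟ f} {⊟ g} (S.-‿cong f≈g)
    xu-≈ : xu ≈ x ⊠ u
    xu-≈ = δ-+ 1 (suc (twice n))
    w-≈ : w ≈ v ⊠ (x ⊠ u)
    w-≈ = S.trans (subst (λ k → w ≈ δ k) (twice-+ m (suc n)) S.refl)
      (S.trans (δ-+ (twice m) (twice (suc n))) (S.*-congˡ {v} xu-≈))
    w′-≈ : δ (twice (suc m + suc n)) ≈ x ⊠ (x ⊠ (v ⊠ (x ⊠ u)))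
    w′-≈ = S.trans (δ-+ 1 (suc (twice (m + suc n))))
      (S.*-congˡ {x} (S.trans (δ-+ 1 (twice (m + suc n))) (S.*-congˡ {x} w-≈)))
    exponent : suc m * suc (twice (suc n)) ≡ m * suc (twice n) + (suc (twice n) + (twice m + (1 + 1)))
    exponent rewrite twice-≡ m | twice-≡ n = lemma m n
      where
      lemma : ∀ m n → (1 + m) * (3 + (n + n)) ≡ m * (1 + (n + n)) + (1 + (n + n) + (m + m + (1 + 1)))
      lemma = solveℕ-∀
    q-≈ : q ≈ p ⊠ (u ⊠ (v ⊠ (x ⊠ x)))
    q-≈ = S.trans (subst (λ k → q ≈ δ k) exponent S.refl)
      (S.trans (δ-+ (m * suc (twice n)) _) (S.*-congˡ {p}
        (S.trans (δ-+ (suc (twice n)) _) (S.*-congˡ {u}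
          (S.trans (δ-+ (twice m) 2) (S.*-congˡ {v} (δ-+ 1 1)))))))
    ratio : Pₘ ⊠ (const 1ℤ ⊞ ⊟ (x ⊠ v)) ≋ Pₘ₊₁ ⊠ (const 1ℤ ⊞ ⊟ (x ⊠ (x ⊠ v)))
    ratio = ≋-trans (≈⇒≋ (S.*-congˡ {Pₘ} (one-minus (S.sym (δ-+ 1 (twice m))))))
      (≋-trans (≋-sym (P-suc m)) (≈⇒≋ (S.*-congˡ {Pₘ₊₁} (one-minus
        (S.trans (δ-+ 1 (suc (twice m))) (S.*-congˡ {x} (δ-+ 1 (twice m))))))))

  -- At m = n the boundary factor of `telescope` is 1 - u² = (1 - u)(1 + u) with u = X^(2n+1). So 1
  -- - u splits off everywhere, and t + ut supplies the next two terms of Ψ, with exponents tri(2n)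
  -- and tri(2n+1).
  partial-Ψ : ∀ n → partial (suc (twice n)) n ≋ P n ⊠ Ψ (twice n)
  partial-Ψ zero = ≈⇒≋ (S.trans (S.sym (S.zeroʳ (P 0))) (S.*-congˡ {P 0} (S.sym (gf-[] (λ _ → 1ℤ) tri))))
  partial-Ψ (suc n) = 1-δ-cancel (suc (twice n)) (partial (suc (twice (suc n))) (suc n)) (P (suc n) ⊠ Ψ (twice (suc n))) (begin
    (const 1ℤ ⊞ ⊟ δ (twice (suc n))) ⊠ partial (suc (twice (suc n))) (suc n)
      ≈⟨ telescope n n ⟩
    (const 1ℤ ⊞ ⊟ u) ⊠ partial (suc (twice n)) n ⊞ P n ⊠ t ⊠ (const 1ℤ ⊞ ⊟ δ (twice (n + suc n)))
      ≈⟨ ⊞-cong (⊠-congˡ (const 1ℤ ⊞ ⊟ u) (partial-Ψ n))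
           (≈⇒≋ (S.*-congˡ {P n ⊠ t} (S.+-congˡ {const 1ℤ} {⊟ δ (twice (n + suc n))} {⊟ (u ⊠ u)} (S.-‿cong uu-≈)))) ⟩
    (const 1ℤ ⊞ ⊟ u) ⊠ (P n ⊠ Ψ (twice n)) ⊞ P n ⊠ t ⊠ (const 1ℤ ⊞ ⊟ (u ⊠ u))
      ≈⟨ ≈⇒≋ (solve 4 (λ u p y t →
           (con 1ℤ :+ :- u) :* (p :* y) :+ p :* t :* (con 1ℤ :+ :- (u :* u)) :=
           p :* (con 1ℤ :+ :- u) :* (y :+ t :+ u :* t)) S.refl u (P n) (Ψ (twice n)) t) ⟩
    P n ⊠ (const 1ℤ ⊞ ⊟ u) ⊠ (Ψ (twice n) ⊞ t ⊞ u ⊠ t)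
      ≈⟨ ⊠-cong (≋-sym (P-suc n)) (≈⇒≋ (S.sym Ψ-≈)) ⟩
    P (suc n) ⊠ (const 1ℤ ⊞ ⊟ δ (twice (suc n))) ⊠ Ψ (twice (suc n))
      ≈⟨ ≈⇒≋ (solve 3 (λ p d y → p :* d :* y := d :* (p :* y)) S.refl
           (P (suc n)) (const 1ℤ ⊞ ⊟ δ (twice (suc n))) (Ψ (twice (suc n)))) ⟩
    (const 1ℤ ⊞ ⊟ δ (twice (suc n))) ⊠ (P (suc n) ⊠ Ψ (twice (suc n))) ∎)
    where
    open SetoidReasoning ≋-setoid
    u = δ (suc (twice n))
    t = δ (n * suc (twice n))
    uu-≈ : δ (twice (n + suc n)) ≈ u ⊠ u
    uu-≈ = S.trans (subst (λ k → δ (twice (n + suc n)) ≈ δ k) exponent S.refl) (δ-+ (suc (twice n)) (suc (twice n)))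
      where
      exponent : twice (n + suc n) ≡ suc (twice n) + suc (twice n)
      exponent = trans (twice-+ n (suc n)) (ℕₚ.+-suc (twice n) (suc (twice n)))
    Ψ-≈ : Ψ (twice (suc n)) ≈ Ψ (twice n) ⊞ t ⊞ u ⊠ t
    Ψ-≈ = S.trans (Ψ-suc (suc (twice n)))
      (S.+-cong {Ψ (suc (twice n))} {Ψ (twice n) ⊞ t} {δ (tri (suc (twice n)))} {u ⊠ t}
        (S.trans (Ψ-suc (twice n)) (subst (λ k → Ψ (twice n) ⊞ δ (tri (twice n)) ≈ Ψ (twice n) ⊞ δ k) (tri-twice n) S.refl))
        (S.trans (subst (λ k → δ (tri (suc (twice n))) ≈ δ (suc (twice n) + k)) (tri-twice n) S.refl)
                 (δ-+ (suc (twice n)) (n * suc (twice n)))))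

  partial-1 : ∀ {e} → N < e → ∀ m → partial e (suc m) ≋ const 1ℤ
  partial-1 N<e zero = ≈⇒≋ (S.trans
    (solve 1 (λ p → con 0ℤ :+ p :* con 1ℤ := p) S.refl (P 0))
    (pointwise λ { zero → refl ; (suc _) → refl }))
  partial-1 {e} N<e (suc m) = begin
    partial e (suc m) ⊞ P (suc m) ⊠ x  ≈⟨ ⊞-cong (partial-1 N<e m) (≈⇒≋ (S.*-comm (P (suc m)) x)) ⟩
    const 1ℤ ⊞ x ⊠ P (suc m)           ≈⟨ ⊞-cong (≋-refl {const 1ℤ}) (δ-≋-0 (ℕₚ.<-≤-trans N<e (ℕₚ.m≤m+n e (m * e))) (P (suc m))) ⟩
    const 1ℤ ⊞ const 0ℤ                ≈⟨ ≈⇒≋ (S.+-identityʳ (const 1ℤ)) ⟩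
    const 1ℤ                           ∎
    where
    open SetoidReasoning ≋-setoid
    x = δ (suc m * e)

  -- The two evaluations of `partial` meet at e = 2(m+1)+1, which exceeds N.
  P-⊠-Ψ : ∀ m → N < twice (suc m) → P (suc m) ⊠ Ψ (twice (suc m)) ≋ const 1ℤ
  P-⊠-Ψ m N< = ≋-trans (≋-sym (partial-Ψ (suc m))) (partial-1 (ℕₚ.m≤n⇒m≤1+n N<) m)

-- Triangular numbers with integer index

T : ℤ → ℕ
T (+ k)    = tri k
T -[1+ k ] = tri k

ints : ℕ → List ℤ
ints B = map +_ (upTo B) ++ map -[1+_] (upTo B)

ints-unique : ∀ B → Unique (ints B)
ints-unique B = Uniqueₚ.++⁺ (Uniqueₚ.map⁺ ℤₚ.+-injective (Uniqueₚ.upTo⁺ B))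
                            (Uniqueₚ.map⁺ ℤₚ.-[1+-injective (Uniqueₚ.upTo⁺ B)) disjoint
  where
  disjoint : ∀ {v} → ¬ (v ∈ map +_ (upTo B) × v ∈ map -[1+_] (upTo B))
  disjoint (p , q) with ∈-map⁻ +_ p | ∈-map⁻ -[1+_] q
  ... | _ , _ , refl | _ , _ , ()

k≤tri : ∀ k → k ≤ tri k
k≤tri zero    = z≤n
k≤tri (suc k) = ℕₚ.m≤m+n (suc k) (tri k)

∈-ints : ∀ {B} k → T k < B → k ∈ ints B
∈-ints (+ k)    T<B = ∈-++⁺ˡ (∈-map⁺ +_ (∈-upTo⁺ (ℕₚ.≤-<-trans (k≤tri k) T<B)))
∈-ints -[1+ k ] T<B = ∈-++⁺ʳ (map +_ (upTo _)) (∈-map⁺ -[1+_] (∈-upTo⁺ (ℕₚ.≤-<-trans (k≤tri k) T<B)))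

-- The symmetry k ↦ -1 - k of `T`, that is x ↦ -x for x = 2k+1, pairs the two halves of `ints`. Its
-- factor 2, cubed, is the 8 in `r₃-coeff`.
∑-ints : ∀ B (f : ℕ → ℤ) → ∑ (ints B) (λ k → f (T k)) ≡ + 2 *ᶻ ∑ (upTo B) (λ k → f (tri k))
∑-ints B f = begin
  ∑ (ints B) (λ k → f (T k))
    ≡⟨ ∑-++ (map +_ (upTo B)) (map -[1+_] (upTo B)) (λ k → f (T k)) ⟩
  ∑ (map +_ (upTo B)) (λ k → f (T k)) +ᶻ ∑ (map -[1+_] (upTo B)) (λ k → f (T k))
    ≡⟨ cong₂ _+ᶻ_ (∑-map +_ (upTo B) (λ k → f (T k))) (∑-map -[1+_] (upTo B) (λ k → f (T k))) ⟩
  s +ᶻ s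
    ≡⟨ double s ⟩
  + 2 *ᶻ s ∎
  where
  open ≡-Reasoning
  s = ∑ (upTo B) (λ k → f (tri k))
  double : ∀ s → s +ᶻ s ≡ + 2 *ᶻ s
  double = solve-∀

double-tri : ∀ k → + 2 *ᶻ + tri k ≡ + k *ᶻ (+ k +ᶻ 1ℤ)
double-tri zero    = refl
double-tri (suc k) = begin
  + 2 *ᶻ + (suc k + tri k)             ≡⟨ cong (+ 2 *ᶻ_) (ℤₚ.pos-+ (suc k) (tri k)) ⟩
  + 2 *ᶻ (+ suc k +ᶻ + tri k)          ≡⟨ ℤₚ.*-distribˡ-+ (+ 2) (+ suc k) (+ tri k) ⟩
  + 2 *ᶻ + suc k +ᶻ + 2 *ᶻ + tri k     ≡⟨ cong (+ 2 *ᶻ + suc k +ᶻ_) (double-tri k) ⟩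
  + 2 *ᶻ (1ℤ +ᶻ + k) +ᶻ + k *ᶻ (+ k +ᶻ 1ℤ) ≡⟨ lemma (+ k) ⟩
  (1ℤ +ᶻ + k) *ᶻ (1ℤ +ᶻ + k +ᶻ 1ℤ)     ∎
  where
  open ≡-Reasoning
  lemma : ∀ k → + 2 *ᶻ (1ℤ +ᶻ k) +ᶻ k *ᶻ (k +ᶻ 1ℤ) ≡ (1ℤ +ᶻ k) *ᶻ (1ℤ +ᶻ k +ᶻ 1ℤ)
  lemma = solve-∀

double-T : ∀ k → + 2 *ᶻ + T k ≡ k *ᶻ (k +ᶻ 1ℤ)
double-T (+ k)    = double-tri k
double-T -[1+ k ] = trans (double-tri k) (lemma (+ k))
  where
  lemma : ∀ k → k *ᶻ (k +ᶻ 1ℤ) ≡ - (1ℤ +ᶻ k) *ᶻ (- (1ℤ +ᶻ k) +ᶻ 1ℤ)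
  lemma = solve-∀

-- With x = 2k+1, d = 2a+1, e = 2b+1, the solutions of T k + 2ab + a + b = i are those of x² + 4de = 8i + 5.

quad : ℕ × ℕ → ℕ
quad (a , b) = 2 * (a * b) + (a + b)

2[quad]+1 : ∀ a b → suc (2 * quad (a , b)) ≡ suc (2 * a) * suc (2 * b)
2[quad]+1 = lemma
  where
  lemma : ∀ a b → 1 + 2 * (2 * (a * b) + (a + b)) ≡ (1 + 2 * a) * (1 + 2 * b)
  lemma = solveℕ-∀

quadᶻ : ℤ → ℤ → ℤ
quadᶻ a b = + 2 *ᶻ (a *ᶻ b) +ᶻ (a +ᶻ b)

quad-pos : ∀ a b → + quad (a , b) ≡ quadᶻ (+ a) (+ b)
quad-pos a b = trans (ℤₚ.pos-+ (2 * (a * b)) (a + b))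
  (cong₂ _+ᶻ_ (trans (ℤₚ.pos-* 2 (a * b)) (cong (+ 2 *ᶻ_) (ℤₚ.pos-* a b))) (ℤₚ.pos-+ a b))

Point : Set
Point = ℤ × ℤ × ℤ

-- Doubled, so that k(k+1)/2 becomes polynomial; the coordinates are integers because `α` subtracts,
-- with positivity stated separately.
Solution : ℕ → Point → Set
Solution i (k , a , b) =
  0ℤ ℤ.≤ a × 0ℤ ℤ.≤ b × k *ᶻ (k +ᶻ 1ℤ) +ᶻ + 2 *ᶻ quadᶻ a b ≡ + 2 *ᶻ + i

-- In x, d, e: `ν` is x ↦ -x, `σ` exchanges d and e, and `α` is (x, d, e) ↦ (-x-2e, d-x-e, e). The
-- last is one branch of Zagier's map (x, d, e) ↦ (x+2e, e, d-x-e), followed by `σν` to make it an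
-- involution.
ν σ σν α : Point → Point
ν  (k , a , b) = - k - 1ℤ , a , b
σ  (k , a , b) = k , b , a
σν (k , a , b) = - k - 1ℤ , b , a
α  (k , a , b) = - k - + 2 *ᶻ b - + 2 , a - k - b - 1ℤ , b

private
  point-≡ : ∀ {k a b k′ a′ b′ : ℤ} → k ≡ k′ → a ≡ a′ → b ≡ b′ → (k , a , b) ≡ (k′ , a′ , b′)
  point-≡ refl refl refl = refl

  reflect : ∀ k → - (- k - 1ℤ) - 1ℤ ≡ k
  reflect = solve-∀

ν-involutive : ∀ p → ν (ν p) ≡ p
ν-involutive (k , a , b) = point-≡ (reflect k) refl refl

σν-involutive : ∀ p → σν (σν p) ≡ p
σν-involutive (k , a , b) = point-≡ (reflect k) refl refl

α-involutive : ∀ p → α (α p) ≡ p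
α-involutive (k , a , b) = point-≡ (eq₁ k b) (eq₂ k a b) refl
  where
  eq₁ : ∀ k b → - (- k - + 2 *ᶻ b - + 2) - + 2 *ᶻ b - + 2 ≡ k
  eq₁ = solve-∀
  eq₂ : ∀ k a b → a - k - b - 1ℤ - (- k - + 2 *ᶻ b - + 2) - b - 1ℤ ≡ a
  eq₂ = solve-∀

ν-Solution : ∀ i p → Solution i p → Solution i (ν p)
ν-Solution i (k , a , b) (0≤a , 0≤b , eq) = 0≤a , 0≤b , trans (lemma k a b) eq
  where
  lemma : ∀ k a b → (- k - 1ℤ) *ᶻ (- k - 1ℤ +ᶻ 1ℤ) +ᶻ + 2 *ᶻ (+ 2 *ᶻ (a *ᶻ b) +ᶻ (a +ᶻ b)) ≡
                    k *ᶻ (k +ᶻ 1ℤ) +ᶻ + 2 *ᶻ (+ 2 *ᶻ (a *ᶻ b) +ᶻ (a +ᶻ b))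
  lemma = solve-∀

σ-Solution : ∀ i p → Solution i p → Solution i (σ p)
σ-Solution i (k , a , b) (0≤a , 0≤b , eq) = 0≤b , 0≤a , trans (lemma k a b) eq
  where
  lemma : ∀ k a b → k *ᶻ (k +ᶻ 1ℤ) +ᶻ + 2 *ᶻ (+ 2 *ᶻ (b *ᶻ a) +ᶻ (b +ᶻ a)) ≡
                    k *ᶻ (k +ᶻ 1ℤ) +ᶻ + 2 *ᶻ (+ 2 *ᶻ (a *ᶻ b) +ᶻ (a +ᶻ b))
  lemma = solve-∀

-- In the notation above: d > x + e and d > e - x.
Low High : Point → Set
Low  (k , a , b) = 0ℤ ℤ.≤ a - k - b - 1ℤ
High (k , a , b) = 0ℤ ℤ.≤ a +ᶻ k - b

low? : Decidable Low
low? (k , a , b) = 0ℤ ℤ.≤? a - k - b - 1ℤ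

high? : Decidable High
high? (k , a , b) = 0ℤ ℤ.≤? a +ᶻ k - b

α-Solution : ∀ i p → Low p → Solution i p → Solution i (α p)
α-Solution i (k , a , b) 0≤c (0≤a , 0≤b , eq) = 0≤c , 0≤b , trans (lemma k a b) eq
  where
  lemma : ∀ k a b →
    (- k - + 2 *ᶻ b - + 2) *ᶻ (- k - + 2 *ᶻ b - + 2 +ᶻ 1ℤ)
      +ᶻ + 2 *ᶻ (+ 2 *ᶻ ((a - k - b - 1ℤ) *ᶻ b) +ᶻ (a - k - b - 1ℤ +ᶻ b)) ≡
    k *ᶻ (k +ᶻ 1ℤ) +ᶻ + 2 *ᶻ (+ 2 *ᶻ (a *ᶻ b) +ᶻ (a +ᶻ b))
  lemma = solve-∀

-- Since `α` is an involution, the first factor of `α (α p)` is a again: `Low` at `α p` just says 0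
-- ≤ a. Hence `α` acts on the low solutions.
α-Low : ∀ i p → Solution i p → Low (α p)
α-Low i (k , a , b) (0≤a , _) = subst (0ℤ ℤ.≤_) (lemma k a b) 0≤a
  where
  lemma : ∀ k a b → a ≡ a - k - b - 1ℤ - (- k - + 2 *ᶻ b - + 2) - b - 1ℤ
  lemma = solve-∀

private
  -- d - x - e and d + x - e are odd and never vanish. In halved coordinates such a number and its
  -- negative become two integers with sum -1, exactly one of which is nonnegative. So `σν`
  -- exchanges low and non-low solutions, and `σ` preserves those that are low but not high.
  ≥0⇒≱0 : ∀ z w → z +ᶻ w ≡ -1ℤ → 0ℤ ℤ.≤ z → ¬ 0ℤ ℤ.≤ w
  ≥0⇒≱0 (+ m) (+ n) () _ _

  ≱0⇒≥0 : ∀ z w → z +ᶻ w ≡ -1ℤ → ¬ 0ℤ ℤ.≤ z → 0ℤ ℤ.≤ w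
  ≱0⇒≥0 (+ m)    w eq z≱0 = contradiction (+≤+ z≤n) z≱0
  ≱0⇒≥0 -[1+ m ] w eq _   = subst (0ℤ ℤ.≤_) (trans (cong (_- -[1+ m ]) (sym eq)) (lemma -[1+ m ] w)) (+≤+ z≤n)
    where
    lemma : ∀ z w → z +ᶻ w - z ≡ w
    lemma = solve-∀

σν-Low⁺ : ∀ p → Low p → ¬ Low (σν p)
σν-Low⁺ (k , a , b) = ≥0⇒≱0 _ _ (lemma k a b)
  where
  lemma : ∀ k a b → (a - k - b - 1ℤ) +ᶻ (b - (- k - 1ℤ) - a - 1ℤ) ≡ -1ℤ
  lemma = solve-∀

σν-Low⁻ : ∀ p → ¬ Low p → Low (σν p)
σν-Low⁻ (k , a , b) = ≱0⇒≥0 _ _ (lemma k a b)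
  where
  lemma : ∀ k a b → (a - k - b - 1ℤ) +ᶻ (b - (- k - 1ℤ) - a - 1ℤ) ≡ -1ℤ
  lemma = solve-∀

ν-Low : ∀ p → High p → Low (ν p)
ν-Low (k , a , b) = subst (0ℤ ℤ.≤_) (lemma k a b)
  where
  lemma : ∀ k a b → a +ᶻ k - b ≡ a - (- k - 1ℤ) - b - 1ℤ
  lemma = solve-∀

ν-High : ∀ p → Low p → High (ν p)
ν-High (k , a , b) = subst (0ℤ ℤ.≤_) (lemma k a b)
  where
  lemma : ∀ k a b → a - k - b - 1ℤ ≡ a +ᶻ (- k - 1ℤ) - b
  lemma = solve-∀

σ-Low : ∀ p → ¬ High p → Low (σ p)
σ-Low (k , a , b) = ≱0⇒≥0 _ _ (lemma k a b)
  where
  lemma : ∀ k a b → (a +ᶻ k - b) +ᶻ (b - k - a - 1ℤ) ≡ -1ℤ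
  lemma = solve-∀

σ-High : ∀ p → Low p → ¬ High (σ p)
σ-High (k , a , b) = ≥0⇒≱0 _ _ (lemma k a b)
  where
  lemma : ∀ k a b → (a - k - b - 1ℤ) +ᶻ (b +ᶻ k - a) ≡ -1ℤ
  lemma = solve-∀

odd : ℤ → ℤ
odd k = + 2 *ᶻ k +ᶻ 1ℤ

weight : Point → ℤ
weight (k , a , b) = odd a *ᶻ (odd a *ᶻ odd b - odd k *ᶻ odd k)

κ : Point → ℤ
κ (k , a , b) = odd k *ᶻ (odd a *ᶻ odd a - odd b *ᶻ odd b)

κ-ν : ∀ p → κ (ν p) ≡ - κ p
κ-ν (k , a , b) = lemma k (odd a *ᶻ odd a - odd b *ᶻ odd b)
  where
  lemma : ∀ k y → (+ 2 *ᶻ (- k - 1ℤ) +ᶻ 1ℤ) *ᶻ y ≡ - ((+ 2 *ᶻ k +ᶻ 1ℤ) *ᶻ y)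
  lemma = solve-∀

κ-σ : ∀ p → κ (σ p) ≡ - κ p
κ-σ (k , a , b) = lemma (odd k) (odd b *ᶻ odd b) (odd a *ᶻ odd a)
  where
  lemma : ∀ x y z → x *ᶻ (y - z) ≡ - (x *ᶻ (z - y))
  lemma = solve-∀

-- The correction κ, which sums to zero over Low, makes the symmetrised weight odd under α.
balanced : Point → ℤ
balanced p = weight p +ᶻ weight (σν p) +ᶻ κ p

-- In x, d, e the polynomial `balanced` is (d + e)(d - x)(e + x). The map `α` exchanges the first
-- two factors and negates the third; `κ` is the term that completes the symmetrised weight (d +
-- e)(de - x²) to this product.
balanced-α : ∀ p → balanced (α p) ≡ - balanced p
balanced-α (k , a , b) = begin
  balanced (α (k , a , b))
    ≡⟨ cong (λ y → form (odd (- k - + 2 *ᶻ b - + 2)) y (odd (a - k - b - 1ℤ)) (odd b)) (odd-ν (- k - + 2 *ᶻ b - + 2)) ⟩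
  form (odd (- k - + 2 *ᶻ b - + 2)) (- odd (- k - + 2 *ᶻ b - + 2)) (odd (a - k - b - 1ℤ)) (odd b)
    ≡⟨ cong₂ (λ x d → form x (- x) d (odd b)) (odd-α₁ k b) (odd-α₂ k a b) ⟩
  form (- odd k - + 2 *ᶻ odd b) (- (- odd k - + 2 *ᶻ odd b)) (odd a - odd k - odd b) (odd b)
    ≡⟨ lemma (odd k) (odd a) (odd b) ⟩
  - form (odd k) (- odd k) (odd a) (odd b)
    ≡⟨ cong (λ y → - form (odd k) y (odd a) (odd b)) (sym (odd-ν k)) ⟩
  - balanced (k , a , b) ∎
  where
  open ≡-Reasoning
  form : ℤ → ℤ → ℤ → ℤ → ℤ
  form x y d e = d *ᶻ (d *ᶻ e - x *ᶻ x) +ᶻ e *ᶻ (e *ᶻ d - y *ᶻ y) +ᶻ x *ᶻ (d *ᶻ d - e *ᶻ e)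
  odd-ν : ∀ k → + 2 *ᶻ (- k - 1ℤ) +ᶻ 1ℤ ≡ - (+ 2 *ᶻ k +ᶻ 1ℤ)
  odd-ν = solve-∀
  odd-α₁ : ∀ k b → + 2 *ᶻ (- k - + 2 *ᶻ b - + 2) +ᶻ 1ℤ ≡ - (+ 2 *ᶻ k +ᶻ 1ℤ) - + 2 *ᶻ (+ 2 *ᶻ b +ᶻ 1ℤ)
  odd-α₁ = solve-∀
  odd-α₂ : ∀ k a b → + 2 *ᶻ (a - k - b - 1ℤ) +ᶻ 1ℤ ≡ + 2 *ᶻ a +ᶻ 1ℤ - (+ 2 *ᶻ k +ᶻ 1ℤ) - (+ 2 *ᶻ b +ᶻ 1ℤ)
  odd-α₂ = solve-∀
  lemma : ∀ x d e →
    (d - x - e) *ᶻ ((d - x - e) *ᶻ e - (- x - + 2 *ᶻ e) *ᶻ (- x - + 2 *ᶻ e))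
      +ᶻ e *ᶻ (e *ᶻ (d - x - e) - (- (- x - + 2 *ᶻ e)) *ᶻ (- (- x - + 2 *ᶻ e)))
      +ᶻ (- x - + 2 *ᶻ e) *ᶻ ((d - x - e) *ᶻ (d - x - e) - e *ᶻ e) ≡
    - (d *ᶻ (d *ᶻ e - x *ᶻ x) +ᶻ e *ᶻ (e *ᶻ d - (- x) *ᶻ (- x)) +ᶻ x *ᶻ (d *ᶻ d - e *ᶻ e))
  lemma = solve-∀

∑-antisymmetric : ∀ {xs : List A} → Unique xs → (φ : A → A) → (∀ {x} → x ∈ xs → φ x ∈ xs) →
                  (∀ x → φ (φ x) ≡ x) → ∀ f → (∀ x → f (φ x) ≡ - f x) → ∑ xs f ≡ 0ℤ
∑-antisymmetric {xs = xs} xs! φ φ-∈ φφ f antisym = self-negative (∑ xs f) (begin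
  ∑ xs f               ≡⟨ sym (∑-reindex xs! xs! φ φ both both f) ⟩
  ∑ xs (λ x → f (φ x)) ≡⟨ ∑-cong xs antisym ⟩
  ∑ xs (λ x → - f x)   ≡⟨ ∑-neg xs f ⟩
  - ∑ xs f             ∎)
  where
  open ≡-Reasoning
  both : ∀ {x} → x ∈ xs → φ x ∈ xs × φ (φ x) ≡ x
  both x∈ = φ-∈ x∈ , φφ _
  self-negative : ∀ z → z ≡ - z → z ≡ 0ℤ
  self-negative (+ zero)  _ = refl
  self-negative (+ suc _) ()
  self-negative -[1+ _ ]  ()

-- The weights of all solutions sum to zero

module Liouville (i : ℕ) (sols : List Point) (sols! : Unique sols)
                 (sound : ∀ {p} → p ∈ sols → Solution i p)
                 (complete : ∀ p → Solution i p → p ∈ sols) where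

  private
    low high-part low-part : List Point
    low       = filter low? sols
    high-part = filter high? low
    low-part  = filter (λ p → ¬? (high? p)) low

    low⁻ : ∀ {p} → p ∈ low → Solution i p × Low p
    low⁻ p∈ with ∈-filter⁻ low? {xs = sols} p∈
    ... | p∈sols , l = sound p∈sols , l

    low⁺ : ∀ p → Solution i p → Low p → p ∈ low
    low⁺ p s l = ∈-filter⁺ low? (complete p s) l

    low! : Unique low
    low! = Uniqueₚ.filter⁺ low? sols!

    -- The low solutions split into those with d > e + |x|, stable under `ν`, and those with |d - e|
    -- < -x, stable under `σ`; `κ` is odd under both maps.
    ∑-κ : ∑ low κ ≡ 0ℤ
    ∑-κ = trans (∑-partition high? low κ) (cong₂ _+ᶻ_
      (∑-antisymmetric (Uniqueₚ.filter⁺ high? low!) ν ν-∈ ν-involutive κ κ-ν)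
      (∑-antisymmetric (Uniqueₚ.filter⁺ (λ p → ¬? (high? p)) low!) σ σ-∈ (λ _ → refl) κ κ-σ))
      where
      ν-∈ : ∀ {p} → p ∈ high-part → ν p ∈ high-part
      ν-∈ {p} p∈ with ∈-filter⁻ high? {xs = low} p∈
      ... | p∈low , h with low⁻ p∈low
      ... | s , l = ∈-filter⁺ high? (low⁺ (ν p) (ν-Solution i p s) (ν-Low p h)) (ν-High p l)
      σ-∈ : ∀ {p} → p ∈ low-part → σ p ∈ low-part
      σ-∈ {p} p∈ with ∈-filter⁻ (λ p → ¬? (high? p)) {xs = low} p∈
      ... | p∈low , h with low⁻ p∈low
      ... | s , l = ∈-filter⁺ (λ p → ¬? (high? p)) (low⁺ (σ p) (σ-Solution i p s) (σ-Low p h)) (σ-High p l)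

    ∑-balanced : ∑ low balanced ≡ 0ℤ
    ∑-balanced = ∑-antisymmetric low! α α-∈ α-involutive balanced balanced-α
      where
      α-∈ : ∀ {p} → p ∈ low → α p ∈ low
      α-∈ {p} p∈ with low⁻ p∈
      ... | s , l = low⁺ (α p) (α-Solution i p l s) (α-Low i p s)

    -- Folds the non-low solutions onto the low ones, where alone `α` acts.
    ∑-reflected : ∑ low (λ p → weight (σν p)) ≡ ∑ (filter (λ p → ¬? (low? p)) sols) weight
    ∑-reflected = ∑-reindex low! (Uniqueₚ.filter⁺ (λ p → ¬? (low? p)) sols!) σν σν to from weight
      where
      to : ∀ {p} → p ∈ low → σν p ∈ filter (λ p → ¬? (low? p)) sols × σν (σν p) ≡ p
      to {p} p∈ with low⁻ p∈
      ... | s , l = ∈-filter⁺ (λ p → ¬? (low? p)) (complete (σν p) (ν-Solution i (σ p) (σ-Solution i p s)))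
                      (σν-Low⁺ p l) , σν-involutive p
      from : ∀ {p} → p ∈ filter (λ p → ¬? (low? p)) sols → σν p ∈ low × σν (σν p) ≡ p
      from {p} p∈ with ∈-filter⁻ (λ p → ¬? (low? p)) {xs = sols} p∈
      ... | p∈sols , l = low⁺ (σν p) (ν-Solution i (σ p) (σ-Solution i p (sound p∈sols))) (σν-Low⁻ p l)
                       , σν-involutive p

  ∑-weight : ∑ sols weight ≡ 0ℤ
  ∑-weight = begin
    ∑ sols weight
      ≡⟨ ∑-partition low? sols weight ⟩
    ∑ low weight +ᶻ ∑ (filter (λ p → ¬? (low? p)) sols) weight
      ≡⟨ cong (∑ low weight +ᶻ_) (sym ∑-reflected) ⟩
    ∑ low weight +ᶻ ∑ low (λ p → weight (σν p))
      ≡⟨ sym (∑-+ low weight (λ p → weight (σν p))) ⟩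
    ∑ low h
      ≡⟨ sym (ℤₚ.+-identityʳ (∑ low h)) ⟩
    ∑ low h +ᶻ 0ℤ
      ≡⟨ cong (∑ low h +ᶻ_) (sym ∑-κ) ⟩
    ∑ low h +ᶻ ∑ low κ
      ≡⟨ sym (∑-+ low h κ) ⟩
    ∑ low balanced
      ≡⟨ ∑-balanced ⟩
    0ℤ ∎
    where
    open ≡-Reasoning
    h : Point → ℤ
    h p = weight p +ᶻ weight (σν p)

-- Solutions in natural coordinates inside a finite box

boxed : ℕ → List (ℤ × ℕ × ℕ)
boxed B = cartesianProduct (ints B) (cartesianProduct (upTo B) (upTo B))

exponent : ℤ × ℕ × ℕ → ℕ
exponent (k , ab) = T k + quad ab

embed : ℤ × ℕ × ℕ → Point
embed (k , a , b) = k , + a , + b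

a≤quad : ∀ a b → a ≤ quad (a , b)
a≤quad a b = ℕₚ.≤-trans (ℕₚ.m≤m+n a b) (ℕₚ.m≤n+m (a + b) (2 * (a * b)))

b≤quad : ∀ a b → b ≤ quad (a , b)
b≤quad a b = ℕₚ.≤-trans (ℕₚ.m≤n+m b a) (ℕₚ.m≤n+m (a + b) (2 * (a * b)))

solution-pos : ∀ k a b → + 2 *ᶻ + exponent (k , a , b) ≡ k *ᶻ (k +ᶻ 1ℤ) +ᶻ + 2 *ᶻ quadᶻ (+ a) (+ b)
solution-pos k a b = begin
  + 2 *ᶻ + (T k + quad (a , b))                 ≡⟨ cong (+ 2 *ᶻ_) (ℤₚ.pos-+ (T k) (quad (a , b))) ⟩
  + 2 *ᶻ (+ T k +ᶻ + quad (a , b))              ≡⟨ ℤₚ.*-distribˡ-+ (+ 2) (+ T k) (+ quad (a , b)) ⟩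
  + 2 *ᶻ + T k +ᶻ + 2 *ᶻ + quad (a , b)         ≡⟨ cong₂ (λ x y → x +ᶻ + 2 *ᶻ y) (double-T k) (quad-pos a b) ⟩
  k *ᶻ (k +ᶻ 1ℤ) +ᶻ + 2 *ᶻ quadᶻ (+ a) (+ b)    ∎
  where open ≡-Reasoning

module _ {i B : ℕ} (i<B : i < B) where

  private
    hit? : Decidable (λ t → exponent t ≡ i)
    hit? t = exponent t ℕₚ.≟ i

    sols : List Point
    sols = map embed (filter hit? (boxed B))

    sols! : Unique sols
    sols! = Uniqueₚ.map⁺ {f = embed} (λ { {_ , _ , _} {_ , _ , _} refl → refl }) (Uniqueₚ.filter⁺ hit?
      (Uniqueₚ.cartesianProduct⁺ (ints-unique B)
        (Uniqueₚ.cartesianProduct⁺ (Uniqueₚ.upTo⁺ B) (Uniqueₚ.upTo⁺ B))))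

    sound : ∀ {p} → p ∈ sols → Solution i p
    sound p∈ with ∈-map⁻ embed p∈
    ... | t@(k , a , b) , t∈ , refl = +≤+ z≤n , +≤+ z≤n ,
      trans (sym (solution-pos k a b)) (cong (λ j → + 2 *ᶻ + j) (proj₂ (∈-filter⁻ hit? {xs = boxed B} t∈)))

    -- The box misses nothing: `T k`, a and b are each at most i, which is below B.
    complete : ∀ p → Solution i p → p ∈ sols
    complete (k , + a , + b) (_ , _ , eq) = ∈-map⁺ embed (∈-filter⁺ hit?
      (∈-cartesianProduct⁺ (∈-ints k (bounded (ℕₚ.m≤m+n (T k) _)))
        (∈-cartesianProduct⁺
          (∈-upTo⁺ (bounded (ℕₚ.≤-trans (a≤quad a b) (ℕₚ.m≤n+m _ (T k)))))
          (∈-upTo⁺ (bounded (ℕₚ.≤-trans (b≤quad a b) (ℕₚ.m≤n+m _ (T k))))))) hit)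
      where
      hit : exponent (k , a , b) ≡ i
      hit = ℤₚ.+-injective (ℤₚ.*-cancelˡ-≡ (+ 2) _ _ (trans (solution-pos k a b) eq))
      bounded : ∀ {j} → j ≤ exponent (k , a , b) → j < B
      bounded j≤ = ℕₚ.≤-<-trans (subst (_ ≤_) hit j≤) i<B

  ∑-boxed-weight : ∑ (filter hit? (boxed B)) (λ t → weight (embed t)) ≡ 0ℤ
  ∑-boxed-weight = trans (sym (∑-map embed (filter hit? (boxed B)) weight))
    (Liouville.∑-weight i sols sols! sound complete)

-- The derivation X d/dX

D : Series → Series
D f n = + n *ᶻ f n

D-⊠ : ∀ f g → D (f ⊠ g) ≈ D f ⊠ g ⊞ f ⊠ D g
D-⊠ f g = pointwise (leibniz f)
  where
  leibniz : ∀ f n → D (f ⊠ g) n ≡ (D f ⊠ g) n +ᶻ (f ⊠ D g) n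
  leibniz f zero = lemma (f 0) (g 0)
    where
    lemma : ∀ a b → 0ℤ *ᶻ (a *ᶻ b) ≡ 0ℤ *ᶻ a *ᶻ b +ᶻ a *ᶻ (0ℤ *ᶻ b)
    lemma = solve-∀
  leibniz f (suc n) = begin
    + suc n *ᶻ (f 0 *ᶻ g (suc n) +ᶻ h)
      ≡⟨ split (+ n) (f 0) (g (suc n)) h ⟩
    f 0 *ᶻ (+ suc n *ᶻ g (suc n)) +ᶻ (+ n *ᶻ h +ᶻ h)
      ≡⟨ cong (λ z → f 0 *ᶻ D g (suc n) +ᶻ (z +ᶻ h)) (leibniz (shift f) n) ⟩
    f 0 *ᶻ D g (suc n) +ᶻ ((D (shift f) ⊠ g) n +ᶻ (shift f ⊠ D g) n +ᶻ h)
      ≡⟨ regroup (f 0) (g (suc n)) (f 0 *ᶻ D g (suc n)) ((D (shift f) ⊠ g) n) ((shift f ⊠ D g) n) h ⟩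
    0ℤ *ᶻ f 0 *ᶻ g (suc n) +ᶻ ((D (shift f) ⊠ g) n +ᶻ h) +ᶻ (f 0 *ᶻ D g (suc n) +ᶻ (shift f ⊠ D g) n)
      ≡⟨ cong (λ z → 0ℤ *ᶻ f 0 *ᶻ g (suc n) +ᶻ z +ᶻ (f 0 *ᶻ D g (suc n) +ᶻ (shift f ⊠ D g) n)) shift-D ⟩
    (D f ⊠ g) (suc n) +ᶻ (f ⊠ D g) (suc n) ∎
    where
    open ≡-Reasoning
    h = (shift f ⊠ g) n
    split : ∀ n a b h → (1ℤ +ᶻ n) *ᶻ (a *ᶻ b +ᶻ h) ≡ a *ᶻ ((1ℤ +ᶻ n) *ᶻ b) +ᶻ (n *ᶻ h +ᶻ h)
    split = solve-∀
    regroup : ∀ a b c x y h → c +ᶻ (x +ᶻ y +ᶻ h) ≡ 0ℤ *ᶻ a *ᶻ b +ᶻ (x +ᶻ h) +ᶻ (c +ᶻ y)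
    regroup = solve-∀
    shift-D : (D (shift f) ⊠ g) n +ᶻ h ≡ (shift (D f) ⊠ g) n
    shift-D = trans (sym (at (S.distribʳ g (D (shift f)) (shift f)) n))
      (at (S.*-congʳ {g} {D (shift f) ⊞ shift f} {shift (D f)} (pointwise λ k → lemma (+ k) (f (suc k)))) n)
      where
      lemma : ∀ k y → k *ᶻ y +ᶻ y ≡ (1ℤ +ᶻ k) *ᶻ y
      lemma = solve-∀

D-δ : ∀ k n → + n *ᶻ δ k n ≡ + k *ᶻ δ k n
D-δ k n with k ℕₚ.≟ n
... | yes refl = refl
... | no  k≢n rewrite δ-≢ k≢n = trans (ℤₚ.*-zeroʳ (+ n)) (sym (ℤₚ.*-zeroʳ (+ k)))

D-gf : ∀ (xs : List A) w e → D (gf xs w e) ≈ gf xs (λ a → + e a *ᶻ w a) e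
D-gf xs w e = pointwise λ n → trans (sym (∑-* (+ n) xs λ a → w a *ᶻ δ (e a) n))
  (∑-cong xs λ a → trans (exchange (+ n) (w a) (δ (e a) n))
    (trans (cong (w a *ᶻ_) (D-δ (e a) n)) (regroup (w a) (+ e a) (δ (e a) n))))
  where
  exchange : ∀ n w d → n *ᶻ (w *ᶻ d) ≡ w *ᶻ (n *ᶻ d)
  exchange = solve-∀
  regroup : ∀ w e d → w *ᶻ (e *ᶻ d) ≡ e *ᶻ w *ᶻ d
  regroup = solve-∀

-- The coefficient of X^n in F is the divisor sum σ(2n+1), for n < B.

pairs : ℕ → List (ℕ × ℕ)
pairs B = cartesianProduct (upTo B) (upTo B)

divisor : ℕ × ℕ → ℤ
divisor (a , _) = odd (+ a)

F : ℕ → Series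
F B = gf (pairs B) divisor quad

Ψ-ints : ∀ B → gf (ints B) (λ _ → 1ℤ) T ≈ const (+ 2) ⊠ Ψ B
Ψ-ints B = pointwise λ n → trans (∑-ints B (λ t → 1ℤ *ᶻ δ t n)) (sym (const-⊠ (+ 2) (Ψ B) n))

-- Four times the difference of the two sides is the Liouville sum. One factor 2 makes Ψ a sum over
-- all integers k; the other turns quad - 4T into de - x², because 2 quad = de - 1 and 8T = x² - 1.
Ψ-⊠-DF : ∀ {B i} → i < B → (Ψ B ⊠ D (F B)) i ≡ + 4 *ᶻ (D (Ψ B) ⊠ F B) i
Ψ-⊠-DF {B} {i} i<B = ℤₚ.*-cancelˡ-≡ (+ 4) u (+ 4 *ᶻ v) (difference-zero (+ 4 *ᶻ u) (+ 4 *ᶻ (+ 4 *ᶻ v)) (begin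
  + 4 *ᶻ u - + 4 *ᶻ (+ 4 *ᶻ v)
    ≡⟨ regroup u v ⟩
  + 2 *ᶻ (+ 2 *ᶻ u) +ᶻ - (+ 8) *ᶻ (+ 2 *ᶻ v)
    ≡⟨ cong₂ (λ x y → + 2 *ᶻ x +ᶻ - (+ 8) *ᶻ y) u-≡ v-≡ ⟩
  + 2 *ᶻ ∑ sols w₁ +ᶻ - (+ 8) *ᶻ ∑ sols w₂
    ≡⟨ sym (cong₂ _+ᶻ_ (∑-* (+ 2) sols w₁) (∑-* (- (+ 8)) sols w₂)) ⟩
  ∑ sols (λ t → + 2 *ᶻ w₁ t) +ᶻ ∑ sols (λ t → - (+ 8) *ᶻ w₂ t)
    ≡⟨ sym (∑-+ sols (λ t → + 2 *ᶻ w₁ t) (λ t → - (+ 8) *ᶻ w₂ t)) ⟩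
  ∑ sols (λ t → + 2 *ᶻ w₁ t +ᶻ - (+ 8) *ᶻ w₂ t)
    ≡⟨ ∑-cong sols weight-≡ ⟩
  ∑ sols (λ t → weight (embed t))
    ≡⟨ ∑-boxed-weight i<B ⟩
  0ℤ ∎))
  where
  open ≡-Reasoning
  u v : ℤ
  u = (Ψ B ⊠ D (F B)) i
  v = (D (Ψ B) ⊠ F B) i
  sols : List (ℤ × ℕ × ℕ)
  sols = filter (λ t → exponent t ℕₚ.≟ i) (boxed B)
  w₁ w₂ : ℤ × ℕ × ℕ → ℤ
  w₁ (k , ab) = 1ℤ *ᶻ (+ quad ab *ᶻ divisor ab)
  w₂ (k , ab) = (+ T k *ᶻ 1ℤ) *ᶻ divisor ab
  Ψℤ : Series
  Ψℤ = gf (ints B) (λ _ → 1ℤ) T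
  u-≡ : + 2 *ᶻ u ≡ ∑ sols w₁
  u-≡ = trans (sym (const-⊠ (+ 2) (Ψ B ⊠ D (F B)) i)) (trans (at chain i) (gf-coeff (boxed B) w₁ exponent i))
    where
    chain : const (+ 2) ⊠ (Ψ B ⊠ D (F B)) ≈ gf (boxed B) w₁ exponent
    chain = S.trans (S.sym (S.*-assoc (const (+ 2)) (Ψ B) (D (F B))))
      (S.trans (S.*-cong (S.sym (Ψ-ints B)) (D-gf (pairs B) divisor quad))
        (gf-⊠ (ints B) (pairs B) (λ _ → 1ℤ) (λ ab → + quad ab *ᶻ divisor ab) T quad))
  v-≡ : + 2 *ᶻ v ≡ ∑ sols w₂
  v-≡ = trans (sym (const-⊠ (+ 2) (D (Ψ B) ⊠ F B) i)) (trans (at chain i) (gf-coeff (boxed B) w₂ exponent i))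
    where
    D-scale : const (+ 2) ⊠ D (Ψ B) ≈ D Ψℤ
    D-scale = pointwise λ n → trans (const-⊠ (+ 2) (D (Ψ B)) n) (trans (exchange (+ n) (Ψ B n))
      (cong (+ n *ᶻ_) (sym (trans (at (Ψ-ints B) n) (const-⊠ (+ 2) (Ψ B) n)))))
      where
      exchange : ∀ n x → + 2 *ᶻ (n *ᶻ x) ≡ n *ᶻ (+ 2 *ᶻ x)
      exchange = solve-∀
    chain : const (+ 2) ⊠ (D (Ψ B) ⊠ F B) ≈ gf (boxed B) w₂ exponent
    chain = S.trans (S.sym (S.*-assoc (const (+ 2)) (D (Ψ B)) (F B)))
      (S.trans (S.*-congʳ {F B} (S.trans D-scale (D-gf (ints B) (λ _ → 1ℤ) T)))
        (gf-⊠ (ints B) (pairs B) (λ k → + T k *ᶻ 1ℤ) divisor T quad))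
  weight-≡ : ∀ t → + 2 *ᶻ w₁ t +ᶻ - (+ 8) *ᶻ w₂ t ≡ weight (embed t)
  weight-≡ (k , a , b) = begin
    + 2 *ᶻ (1ℤ *ᶻ (+ quad (a , b) *ᶻ d)) +ᶻ - (+ 8) *ᶻ ((+ T k *ᶻ 1ℤ) *ᶻ d)
      ≡⟨ factor d (+ quad (a , b)) (+ T k) ⟩
    d *ᶻ (+ 2 *ᶻ + quad (a , b) - + 4 *ᶻ (+ 2 *ᶻ + T k))
      ≡⟨ cong₂ (λ x y → d *ᶻ (+ 2 *ᶻ x - + 4 *ᶻ y)) (quad-pos a b) (double-T k) ⟩
    d *ᶻ (+ 2 *ᶻ quadᶻ (+ a) (+ b) - + 4 *ᶻ (k *ᶻ (k +ᶻ 1ℤ)))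
      ≡⟨ cong (d *ᶻ_) (squares (+ a) (+ b) k) ⟩
    weight (k , + a , + b) ∎
    where
    d = odd (+ a)
    factor : ∀ d q t → + 2 *ᶻ (1ℤ *ᶻ (q *ᶻ d)) +ᶻ - (+ 8) *ᶻ ((t *ᶻ 1ℤ) *ᶻ d) ≡ d *ᶻ (+ 2 *ᶻ q - + 4 *ᶻ (+ 2 *ᶻ t))
    factor = solve-∀
    squares : ∀ a b k → + 2 *ᶻ (+ 2 *ᶻ (a *ᶻ b) +ᶻ (a +ᶻ b)) - + 4 *ᶻ (k *ᶻ (k +ᶻ 1ℤ)) ≡
              (+ 2 *ᶻ a +ᶻ 1ℤ) *ᶻ (+ 2 *ᶻ b +ᶻ 1ℤ) - (+ 2 *ᶻ k +ᶻ 1ℤ) *ᶻ (+ 2 *ᶻ k +ᶻ 1ℤ)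
    squares = solve-∀
  regroup : ∀ u v → + 4 *ᶻ u - + 4 *ᶻ (+ 4 *ᶻ v) ≡ + 2 *ᶻ (+ 2 *ᶻ u) +ᶻ - (+ 8) *ᶻ (+ 2 *ᶻ v)
  regroup = solve-∀
  difference-zero : ∀ x y → x - y ≡ 0ℤ → x ≡ y
  difference-zero = ℤₚ.i-j≡0⇒i≡j

-- Jacobi's identity for Ψ⁴

Ψ-0 : ∀ B → Ψ (suc B) 0 ≡ 1ℤ
Ψ-0 B = gf-constant (upTo (suc B)) (λ _ → 1ℤ) (Uniqueₚ.upTo⁺ (suc B)) (∈-upTo⁺ (s≤s z≤n)) tri refl
  λ { {zero} _ _ → refl ; {suc _} _ () }

F-0 : ∀ B → F (suc B) 0 ≡ 1ℤ
F-0 B = gf-constant (pairs (suc B)) divisor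
  (Uniqueₚ.cartesianProduct⁺ (Uniqueₚ.upTo⁺ (suc B)) (Uniqueₚ.upTo⁺ (suc B)))
  (∈-cartesianProduct⁺ 0∈ 0∈) quad refl
  λ { {a , b} _ q≡0 → cong₂ _,_ (ℕₚ.n≤0⇒n≡0 (subst (a ≤_) q≡0 (a≤quad a b)))
                                 (ℕₚ.n≤0⇒n≡0 (subst (b ≤_) q≡0 (b≤quad a b))) }
  where
  0∈ : 0 ∈ upTo (suc B)
  0∈ = ∈-upTo⁺ (s≤s z≤n)

infixr 8 _^ˢ_
-- Nested to the right and ending in `const 1ℤ`, so that it agrees by computation with the solver's
-- `:^`.
_^ˢ_ : Series → ℕ → Series
f ^ˢ zero  = const 1ℤ
f ^ˢ suc n = f ⊠ f ^ˢ n

module FourthPower (N B : ℕ) (N≤B : N ≤ B) where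

  open Truncation 0ℤ N

  ~⇒≡ : ∀ {a b} → a ~ b → a ≡ b
  ~⇒≡ {b = b} (q , eq) = trans eq (lemma b q)
    where
    lemma : ∀ b q → b +ᶻ 0ℤ *ᶻ q ≡ b
    lemma = solve-∀

  D-cong : ∀ {f g} → f ≋ g → D f ≋ D g
  D-cong p = upTo-N λ i i≤N → *-cong (~-refl {+ i}) (coeff p i i≤N)

  -- The place where modulus 0 matters: modulo 7 the derivation would also kill every power of X^7.
  constant : ∀ {f} → D f ≋ const 0ℤ → f ≋ const (f 0)
  constant {f} p = upTo-N go
    where
    go : ∀ i → i ≤ N → f i ~ const (f 0) i
    go zero    _   = ~-refl
    go (suc i) i≤N with ℤₚ.i*j≡0⇒i≡0∨j≡0 (+ suc i) (~⇒≡ (coeff p (suc i) i≤N))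
    ... | inj₂ fi≡0 = ~-reflexive fi≡0

  module _ (P : Series) (PΨ : P ⊠ Ψ (suc B) ≋ const 1ℤ) where

    private
      Y G P⁴ : Series
      Y  = Ψ (suc B)
      G  = F (suc B)
      P⁴ = P ⊠ P ⊠ P ⊠ P

      PY-leibniz : D P ⊠ Y ⊞ P ⊠ D Y ≋ const 0ℤ
      PY-leibniz = ≋-trans (≋-sym (≈⇒≋ (D-⊠ P Y))) (≋-trans (D-cong PΨ) (≈⇒≋ (pointwise
        λ { zero → refl ; (suc n) → ℤₚ.*-zeroʳ (+ suc n) })))

      DP⁴ : D P⁴ ≈ const (+ 4) ⊠ (P ⊠ P ⊠ P ⊠ D P)
      DP⁴ = begin
        D P⁴
          ≈⟨ D-⊠ (P ⊠ P ⊠ P) P ⟩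
        D (P ⊠ P ⊠ P) ⊠ P ⊞ P ⊠ P ⊠ P ⊠ D P
          ≈⟨ S.+-congʳ (S.*-congʳ {P} (S.trans (D-⊠ (P ⊠ P) P) (S.+-congʳ {P ⊠ P ⊠ D P} (S.*-congʳ {P} (D-⊠ P P))))) ⟩
        ((D P ⊠ P ⊞ P ⊠ D P) ⊠ P ⊞ P ⊠ P ⊠ D P) ⊠ P ⊞ P ⊠ P ⊠ P ⊠ D P
          ≈⟨ solve 2 (λ p q → ((q :* p :+ p :* q) :* p :+ p :* p :* q) :* p :+ p :* p :* p :* q :=
                              con (+ 4) :* (p :* p :* p :* q)) S.refl P (D P) ⟩
        const (+ 4) ⊠ (P ⊠ P ⊠ P ⊠ D P) ∎
        where open SetoidReasoning ≈-setoid

      -- The Leibniz rule gives 4P³P′G + P⁴G′. Multiplying by PY = 1 creates YG′, which equals 4Y′G,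
      -- and then P′Y + PY′ = (PY)′ = 0 factors out.
      D-product : D (P⁴ ⊠ G) ≋ const 0ℤ
      D-product = begin
        D (P⁴ ⊠ G)
          ≈⟨ ≈⇒≋ (S.trans (D-⊠ P⁴ G) (S.+-congʳ {P⁴ ⊠ D G} (S.*-congʳ {G} DP⁴))) ⟩
        const (+ 4) ⊠ (P ⊠ P ⊠ P ⊠ D P) ⊠ G ⊞ P⁴ ⊠ D G
          ≈⟨ ≈⇒≋ (solve 4 (λ p q g g′ → con (+ 4) :* (p :* p :* p :* q) :* g :+ p :* p :* p :* p :* g′ :=
               (con (+ 4) :* (p :* p :* p :* q) :* g :+ p :* p :* p :* p :* g′) :* con 1ℤ) S.refl P (D P) G (D G)) ⟩
        (const (+ 4) ⊠ (P ⊠ P ⊠ P ⊠ D P) ⊠ G ⊞ P⁴ ⊠ D G) ⊠ const 1ℤ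
          ≈⟨ ⊠-congˡ (const (+ 4) ⊠ (P ⊠ P ⊠ P ⊠ D P) ⊠ G ⊞ P⁴ ⊠ D G) (≋-sym PΨ) ⟩
        (const (+ 4) ⊠ (P ⊠ P ⊠ P ⊠ D P) ⊠ G ⊞ P⁴ ⊠ D G) ⊠ (P ⊠ Y)
          ≈⟨ ≈⇒≋ (solve 5 (λ p q g g′ y →
               (con (+ 4) :* (p :* p :* p :* q) :* g :+ p :* p :* p :* p :* g′) :* (p :* y) :=
               con (+ 4) :* (p :* p :* p :* p) :* g :* (q :* y) :+ p :* p :* p :* p :* p :* (y :* g′))
               S.refl P (D P) G (D G) Y) ⟩
        const (+ 4) ⊠ P⁴ ⊠ G ⊠ (D P ⊠ Y) ⊞ P⁴ ⊠ P ⊠ (Y ⊠ D G)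
          ≈⟨ ⊞-cong (≋-refl {const (+ 4) ⊠ P⁴ ⊠ G ⊠ (D P ⊠ Y)}) (⊠-congˡ (P⁴ ⊠ P) YDG) ⟩
        const (+ 4) ⊠ P⁴ ⊠ G ⊠ (D P ⊠ Y) ⊞ P⁴ ⊠ P ⊠ (const (+ 4) ⊠ (D Y ⊠ G))
          ≈⟨ ≈⇒≋ (solve 5 (λ p q g y y′ →
               con (+ 4) :* (p :* p :* p :* p) :* g :* (q :* y) :+ p :* p :* p :* p :* p :* (con (+ 4) :* (y′ :* g)) :=
               con (+ 4) :* (p :* p :* p :* p) :* g :* (q :* y :+ p :* y′))
               S.refl P (D P) G Y (D Y)) ⟩
        const (+ 4) ⊠ P⁴ ⊠ G ⊠ (D P ⊠ Y ⊞ P ⊠ D Y)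
          ≈⟨ ⊠-congˡ (const (+ 4) ⊠ P⁴ ⊠ G) PY-leibniz ⟩
        const (+ 4) ⊠ P⁴ ⊠ G ⊠ const 0ℤ
          ≈⟨ ≈⇒≋ (S.zeroʳ (const (+ 4) ⊠ P⁴ ⊠ G)) ⟩
        const 0ℤ ∎
        where
        open SetoidReasoning ≋-setoid
        YDG : Y ⊠ D G ≋ const (+ 4) ⊠ (D Y ⊠ G)
        YDG = upTo-N λ i i≤N → ~-reflexive (trans (Ψ-⊠-DF (s≤s (ℕₚ.≤-trans i≤N N≤B)))
          (sym (const-⊠ (+ 4) (D Y ⊠ G) i)))

      constant-term : (P⁴ ⊠ G) 0 ≡ 1ℤ
      constant-term = cong₂ (λ p g → p *ᶻ p *ᶻ p *ᶻ p *ᶻ g) P0 (F-0 B)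
        where
        P0 : P 0 ≡ 1ℤ
        P0 = trans (sym (ℤₚ.*-identityʳ (P 0)))
          (trans (cong (P 0 *ᶻ_) (sym (Ψ-0 B))) (~⇒≡ (coeff PΨ 0 z≤n)))

    F-≋-Ψ⁴ : F (suc B) ≋ Ψ (suc B) ^ˢ 4
    F-≋-Ψ⁴ = begin
      G
        ≈⟨ ≈⇒≋ (solve 1 (λ g → g := con 1ℤ :* (con 1ℤ :* (con 1ℤ :* (con 1ℤ :* g)))) S.refl G) ⟩
      one ⊠ (one ⊠ (one ⊠ (one ⊠ G)))
        ≈⟨ ≋-sym (⊠-cong PΨ (⊠-cong PΨ (⊠-cong PΨ (⊠-congʳ G PΨ)))) ⟩
      (P ⊠ Y) ⊠ ((P ⊠ Y) ⊠ ((P ⊠ Y) ⊠ ((P ⊠ Y) ⊠ G)))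
        ≈⟨ ≈⇒≋ (solve 3 (λ p y g → (p :* y) :* ((p :* y) :* ((p :* y) :* ((p :* y) :* g))) :=
             (p :* p :* p :* p :* g) :* (y :* (y :* (y :* (y :* con 1ℤ))))) S.refl P Y G) ⟩
      (P⁴ ⊠ G) ⊠ Y ^ˢ 4
        ≈⟨ ⊠-congʳ (Y ^ˢ 4) (constant D-product) ⟩
      const ((P⁴ ⊠ G) 0) ⊠ Y ^ˢ 4
        ≡⟨ cong (λ z → const z ⊠ Y ^ˢ 4) constant-term ⟩
      one ⊠ Y ^ˢ 4
        ≈⟨ ≈⇒≋ (S.*-identityˡ (Y ^ˢ 4)) ⟩
      Y ^ˢ 4 ∎
      where
      open SetoidReasoning ≋-setoid
      one = const 1ℤ

-- Reduction modulo 7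

open Congruence (+ 7)

∑-~0 : ∀ (xs : List A) {f} → (∀ {x} → x ∈ xs → f x ~ 0ℤ) → ∑ xs f ~ 0ℤ
∑-~0 []       p = ~-refl
∑-~0 (x ∷ xs) p = +-cong (p (here refl)) (∑-~0 xs (λ x∈ → p (there x∈)))

δ-^ : ∀ n k → δ (n * k) ≈ δ k ^ˢ n
δ-^ zero    k = S.refl
δ-^ (suc n) k = S.trans (δ-+ k (n * k)) (S.*-congˡ {δ k} (δ-^ n k))

module _ (N : ℕ) where
  open Truncation (+ 7) N using (_≋_; upTo-N; ≈⇒≋; ≋-setoid; ≋-refl; ⊞-cong)

  frobenius-+ : ∀ f g → (f ⊞ g) ^ˢ 7 ≋ f ^ˢ 7 ⊞ g ^ˢ 7
  frobenius-+ f g = begin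
    (f ⊞ g) ^ˢ 7
      -- The coefficients 1, 3, 5, 5, 3, 1 are the inner binomials 7, 21, 35, 35, 21, 7 divided by
      -- 7.
      ≈⟨ ≈⇒≋ (solve 2 (λ x y → (x :+ y) :^ 7 := x :^ 7 :+ y :^ 7 :+ con (+ 7) :*
           (x :^ 6 :* y :+ con (+ 3) :* (x :^ 5 :* y :^ 2) :+ con (+ 5) :* (x :^ 4 :* y :^ 3)
             :+ con (+ 5) :* (x :^ 3 :* y :^ 4) :+ con (+ 3) :* (x :^ 2 :* y :^ 5) :+ x :* y :^ 6))
           S.refl f g) ⟩
    f ^ˢ 7 ⊞ g ^ˢ 7 ⊞ const (+ 7) ⊠ h
      ≈⟨ ⊞-cong (≋-refl {f ^ˢ 7 ⊞ g ^ˢ 7}) multiple ⟩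
    f ^ˢ 7 ⊞ g ^ˢ 7 ⊞ const 0ℤ
      ≈⟨ ≈⇒≋ (S.+-identityʳ (f ^ˢ 7 ⊞ g ^ˢ 7)) ⟩
    f ^ˢ 7 ⊞ g ^ˢ 7 ∎
    where
    open SetoidReasoning ≋-setoid
    h : Series
    h = f ^ˢ 6 ⊠ g ⊞ const (+ 3) ⊠ (f ^ˢ 5 ⊠ g ^ˢ 2) ⊞ const (+ 5) ⊠ (f ^ˢ 4 ⊠ g ^ˢ 3)
          ⊞ const (+ 5) ⊠ (f ^ˢ 3 ⊠ g ^ˢ 4) ⊞ const (+ 3) ⊠ (f ^ˢ 2 ⊠ g ^ˢ 5) ⊞ f ⊠ g ^ˢ 6
    zero-const : ∀ i → const 0ℤ i ≡ 0ℤ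
    zero-const zero    = refl
    zero-const (suc _) = refl
    multiple : const (+ 7) ⊠ h ≋ const 0ℤ
    multiple = upTo-N λ i _ → h i , trans (const-⊠ (+ 7) h i)
      (sym (trans (cong (_+ᶻ + 7 *ᶻ h i) (zero-const i)) (ℤₚ.+-identityˡ (+ 7 *ᶻ h i))))

  frobenius : ∀ (xs : List A) e → gf xs (λ _ → 1ℤ) e ^ˢ 7 ≋ gf xs (λ _ → 1ℤ) (λ a → 7 * e a)
  frobenius [] e = ≈⇒≋ (begin
    gf [] (λ _ → 1ℤ) e ^ˢ 7    ≈⟨ S.*-congʳ {gf [] (λ _ → 1ℤ) e ^ˢ 6} (gf-[] (λ _ → 1ℤ) e) ⟩
    const 0ℤ ⊠ gf [] (λ _ → 1ℤ) e ^ˢ 6 ≈⟨ S.zeroˡ (gf [] (λ _ → 1ℤ) e ^ˢ 6) ⟩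
    const 0ℤ                   ≈⟨ S.sym (gf-[] (λ _ → 1ℤ) (λ a → 7 * e a)) ⟩
    gf [] (λ _ → 1ℤ) (λ a → 7 * e a) ∎)
    where open SetoidReasoning ≈-setoid
  frobenius (x ∷ xs) e = begin
    gf (x ∷ xs) (λ _ → 1ℤ) e ^ˢ 7
      ≈⟨ ≈⇒≋ (^-cong 7 (gf-∷ x xs (λ _ → 1ℤ) e)) ⟩
    (const 1ℤ ⊠ δ (e x) ⊞ gf xs (λ _ → 1ℤ) e) ^ˢ 7
      ≈⟨ frobenius-+ (const 1ℤ ⊠ δ (e x)) (gf xs (λ _ → 1ℤ) e) ⟩
    (const 1ℤ ⊠ δ (e x)) ^ˢ 7 ⊞ gf xs (λ _ → 1ℤ) e ^ˢ 7
      ≈⟨ ⊞-cong (≈⇒≋ power) (frobenius xs e) ⟩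
    const 1ℤ ⊠ δ (7 * e x) ⊞ gf xs (λ _ → 1ℤ) (λ a → 7 * e a)
      ≈⟨ ≈⇒≋ (S.sym (gf-∷ x xs (λ _ → 1ℤ) (λ a → 7 * e a))) ⟩
    gf (x ∷ xs) (λ _ → 1ℤ) (λ a → 7 * e a) ∎
    where
    open SetoidReasoning ≋-setoid
    ^-cong : ∀ n {f g} → f ≈ g → f ^ˢ n ≈ g ^ˢ n
    ^-cong zero    p = S.refl
    ^-cong (suc n) p = S.*-cong p (^-cong n p)
    power : (const 1ℤ ⊠ δ (e x)) ^ˢ 7 ≈ const 1ℤ ⊠ δ (7 * e x)
    power = S.trans (^-cong 7 (S.*-identityˡ (δ (e x))))
      (S.trans (S.sym (δ-^ 7 (e x))) (S.sym (S.*-identityˡ (δ (7 * e x)))))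

-- Extraction of the coefficients of X^(7n+3)

U : Series → Series
U f n = f (7 * n + 3)

-- Multiplication by X^(7k) keeps each exponent in its class modulo 7, so a series in X^7 can be
-- pulled out of the extraction.
U-δ : ∀ k f → U (δ (7 * k) ⊠ f) ≈ δ k ⊠ U f
U-δ k f = pointwise go
  where
  go : ∀ n → U (δ (7 * k) ⊠ f) n ≡ (δ k ⊠ U f) n
  go n with k ℕₚ.≤? n
  ... | no k≰n = trans (δ-⊠-< (7 * k) f below) (sym (δ-⊠-< k (U f) n<k))
    where
    n<k = ℕₚ.≰⇒> k≰n
    below : 7 * n + 3 < 7 * k
    below = ℕₚ.<-≤-trans (ℕₚ.+-monoʳ-< (7 * n) (s≤s (s≤s (s≤s (s≤s z≤n)))))
      (ℕₚ.≤-trans (ℕₚ.≤-reflexive (lemma n)) (ℕₚ.*-monoʳ-≤ 7 n<k))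
      where
      lemma : ∀ n → 7 * n + 7 ≡ 7 * (1 + n)
      lemma = solveℕ-∀
  ... | yes k≤n with ℕₚ.m≤n⇒∃[o]m+o≡n k≤n
  ... | m , refl = begin
    (δ (7 * k) ⊠ f) (7 * (k + m) + 3)     ≡⟨ cong (δ (7 * k) ⊠ f) (lemma k m) ⟩
    (δ (7 * k) ⊠ f) (7 * k + (7 * m + 3)) ≡⟨ δ-⊠-+ (7 * k) f (7 * m + 3) ⟩
    U f m                                 ≡⟨ sym (δ-⊠-+ k (U f) m) ⟩
    (δ k ⊠ U f) (k + m)                   ∎
    where
    open ≡-Reasoning
    lemma : ∀ k m → 7 * (k + m) + 3 ≡ 7 * k + (7 * m + 3)
    lemma = solveℕ-∀

U-gf : ∀ (xs : List A) e f → U (f ⊠ gf xs (λ _ → 1ℤ) (λ a → 7 * e a)) ≈ U f ⊠ gf xs (λ _ → 1ℤ) e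
U-gf [] e f = pointwise λ n → begin
  (f ⊠ gf [] (λ _ → 1ℤ) (λ a → 7 * e a)) (7 * n + 3) ≡⟨ at (vanish f (λ a → 7 * e a)) (7 * n + 3) ⟩
  const 0ℤ (7 * n + 3)                               ≡⟨ zero-const (7 * n + 3) n ⟩
  const 0ℤ n                                         ≡⟨ sym (at (vanish (U f) e) n) ⟩
  (U f ⊠ gf [] (λ _ → 1ℤ) e) n                       ∎
  where
  open ≡-Reasoning
  vanish : ∀ f (e : A → ℕ) → f ⊠ gf [] (λ _ → 1ℤ) e ≈ const 0ℤ
  vanish f e = S.trans (S.*-congˡ {f} (gf-[] (λ _ → 1ℤ) e)) (S.zeroʳ f)
  zero-const : ∀ i j → const 0ℤ i ≡ const 0ℤ j
  zero-const zero    zero    = refl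
  zero-const zero    (suc _) = refl
  zero-const (suc _) zero    = refl
  zero-const (suc _) (suc _) = refl
U-gf (x ∷ xs) e f = pointwise λ n → begin
  (f ⊠ gf (x ∷ xs) (λ _ → 1ℤ) (λ a → 7 * e a)) (7 * n + 3)
    ≡⟨ at (expand f (λ a → 7 * e a)) (7 * n + 3) ⟩
  U (δ (7 * e x) ⊠ f) n +ᶻ U (f ⊠ gf xs (λ _ → 1ℤ) (λ a → 7 * e a)) n
    ≡⟨ cong₂ _+ᶻ_ (at (U-δ (e x) f) n) (at (U-gf xs e f) n) ⟩
  (δ (e x) ⊠ U f) n +ᶻ (U f ⊠ gf xs (λ _ → 1ℤ) e) n
    ≡⟨ sym (at (expand (U f) e) n) ⟩
  (U f ⊠ gf (x ∷ xs) (λ _ → 1ℤ) e) n ∎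
  where
  open ≡-Reasoning
  expand : ∀ f e → f ⊠ gf (x ∷ xs) (λ _ → 1ℤ) e ≈ δ (e x) ⊠ f ⊞ f ⊠ gf xs (λ _ → 1ℤ) e
  expand f e = S.trans (S.*-congˡ {f} (gf-∷ x xs (λ _ → 1ℤ) e))
    (solve 3 (λ f d g → f :* (con 1ℤ :* d :+ g) := d :* f :+ f :* g) S.refl f (δ (e x)) (gf xs (λ _ → 1ℤ) e))

-- σ(7k) ≡ σ(k) modulo 7: a factorisation (2a+1)(2b+1) of 7k either has 7 ∣ 2a+1, or b = 7c+3.
module _ {B m : ℕ} (bound : 7 * m + 3 < B) where

  private
    hit : ∀ j → Decidable (λ ab → quad ab ≡ j)
    hit j ab = quad ab ℕₚ.≟ j

    -- b ≡ 3 modulo 7, equivalently 7 divides 2b+1; stated with b + 4 to avoid subtraction. For b =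
    -- 7c+3 the quotient (b+4)/7 is c+1, hence the predecessor in `lower`.
    Ramified : ℕ × ℕ → Set
    Ramified (_ , b) = 7 ℕDiv.∣ b + 4

    ramified? : Decidable Ramified
    ramified? (_ , b) = 7 ∣? b + 4

    lift lower : ℕ × ℕ → ℕ × ℕ
    lift  (a , b) = a , 7 * b + 3
    lower (a , b) = a , ℕ.pred ((b + 4) / 7)

    lift-+4 : ∀ c → 7 * c + 3 + 4 ≡ suc c * 7
    lift-+4 = lemma
      where
      lemma : ∀ c → 7 * c + 3 + 4 ≡ (1 + c) * 7
      lemma = solveℕ-∀

    lower-lift : ∀ ab → lower (lift ab) ≡ ab
    lower-lift (a , c) = cong (λ j → a , ℕ.pred j) (trans (cong (_/ 7) (lift-+4 c)) (m*n/n≡m (suc c) 7))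

    -- `lift` multiplies the factor 2b+1 by 7 and keeps the divisor 2a+1 that is being summed.
    quad-lift : ∀ a b → quad (lift (a , b)) ≡ 7 * quad (a , b) + 3
    quad-lift = lemma
      where
      lemma : ∀ a b → 2 * (a * (7 * b + 3)) + (a + (7 * b + 3)) ≡ 7 * (2 * (a * b) + (a + b)) + 3
      lemma = solveℕ-∀

    in-pairs : ∀ a b → quad (a , b) < B → (a , b) ∈ pairs B
    in-pairs a b q<B = ∈-cartesianProduct⁺ (∈-upTo⁺ (ℕₚ.≤-<-trans (a≤quad a b) q<B))
                                           (∈-upTo⁺ (ℕₚ.≤-<-trans (b≤quad a b) q<B))

    pairs! : Unique (pairs B)
    pairs! = Uniqueₚ.cartesianProduct⁺ (Uniqueₚ.upTo⁺ B) (Uniqueₚ.upTo⁺ B)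

    at-m at-7m+3 : List (ℕ × ℕ)
    at-m    = filter (hit m) (pairs B)
    at-7m+3 = filter (hit (7 * m + 3)) (pairs B)

    to : ∀ {ab} → ab ∈ at-m → lift ab ∈ filter ramified? at-7m+3 × lower (lift ab) ≡ ab
    to {a , b} ab∈ with ∈-filter⁻ (hit m) {xs = pairs B} ab∈
    ... | _ , refl = ∈-filter⁺ ramified? (∈-filter⁺ (hit (7 * m + 3))
                       (in-pairs a (7 * b + 3) (subst (_< B) (sym (quad-lift a b)) bound)) (quad-lift a b))
                       (divides (suc b) (lift-+4 b))
                   , lower-lift (a , b)

    from : ∀ {ab} → ab ∈ filter ramified? at-7m+3 → lower ab ∈ at-m × lift (lower ab) ≡ ab
    from {a , b} ab∈ with ∈-filter⁻ ramified? {xs = at-7m+3} ab∈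
    ... | ab∈′ , divides zero eq = contradiction (trans (ℕₚ.+-comm 4 b) eq) λ ()
    ... | ab∈′ , divides (suc c) eq with ℕₚ.+-cancelʳ-≡ 4 b (7 * c + 3) (trans eq (sym (lift-+4 c)))
    ... | refl = subst (_∈ at-m) (sym (lower-lift (a , c)))
                   (∈-filter⁺ (hit m) (in-pairs a c (ℕₚ.≤-<-trans q≤ bound)) q≡)
               , cong lift (lower-lift (a , c))
      where
      q≡ : quad (a , c) ≡ m
      q≡ = ℕₚ.*-cancelˡ-≡ _ _ 7 (ℕₚ.+-cancelʳ-≡ 3 _ _
        (trans (sym (quad-lift a c)) (proj₂ (∈-filter⁻ (hit (7 * m + 3)) {xs = pairs B} ab∈′))))
      q≤ : quad (a , c) ≤ 7 * m + 3
      q≤ = ℕₚ.≤-trans (ℕₚ.≤-reflexive q≡) (ℕₚ.≤-trans (ℕₚ.m≤n*m m 7) (ℕₚ.m≤m+n (7 * m) 3))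

    unramified : ∀ {ab} → ab ∈ filter (λ ab → ¬? (ramified? ab)) at-7m+3 → divisor ab ~ 0ℤ
    unramified {a , b} ab∈ with ∈-filter⁻ (λ ab → ¬? (ramified? ab)) {xs = at-7m+3} ab∈
    ... | ab∈′ , ¬ram with euclidsLemma (suc (2 * a)) (suc (2 * b)) (from-yes (prime? 7))
                             (divides (suc (2 * m)) product)
      where
      product : suc (2 * a) * suc (2 * b) ≡ suc (2 * m) * 7
      product = begin
        suc (2 * a) * suc (2 * b) ≡⟨ sym (2[quad]+1 a b) ⟩
        suc (2 * quad (a , b))    ≡⟨ cong (λ j → suc (2 * j)) (proj₂ (∈-filter⁻ (hit (7 * m + 3)) {xs = pairs B} ab∈′)) ⟩
        suc (2 * (7 * m + 3))     ≡⟨ lemma m ⟩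
        suc (2 * m) * 7           ∎
        where
        open ≡-Reasoning
        lemma : ∀ m → 1 + 2 * (7 * m + 3) ≡ (1 + 2 * m) * 7
        lemma = solveℕ-∀
    ... | inj₁ (divides q eq) = + q , (begin
      + 2 *ᶻ + a +ᶻ 1ℤ     ≡⟨ cong (_+ᶻ 1ℤ) (sym (ℤₚ.pos-* 2 a)) ⟩
      + (2 * a + 1)        ≡⟨ cong +_ (trans (ℕₚ.+-comm (2 * a) 1) (trans eq (ℕₚ.*-comm q 7))) ⟩
      + (7 * q)            ≡⟨ ℤₚ.pos-* 7 q ⟩
      + 7 *ᶻ + q           ≡⟨ sym (ℤₚ.+-identityˡ (+ 7 *ᶻ + q)) ⟩
      0ℤ +ᶻ + 7 *ᶻ + q     ∎)
      where open ≡-Reasoning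
    -- 4 inverts 2 modulo 7: 4(2b+1) = 7b + (b+4).
    ... | inj₂ 7∣d = contradiction (ℕDiv.∣m+n∣m⇒∣n (subst (7 ℕDiv.∣_) (lemma b) (ℕDiv.∣n⇒∣m*n 4 7∣d)) (ℕDiv.m∣m*n b)) ¬ram
      where
      lemma : ∀ b → 4 * (1 + 2 * b) ≡ 7 * b + (b + 4)
      lemma = solveℕ-∀

  F-7m+3 : F B (7 * m + 3) ~ F B m
  F-7m+3 = ~-trans (~-reflexive (trans (gf-coeff (pairs B) divisor quad (7 * m + 3)) (∑-partition ramified? at-7m+3 divisor)))
    (~-trans (+-cong
      (~-reflexive (sym (∑-reindex (Uniqueₚ.filter⁺ (hit m) pairs!)
        (Uniqueₚ.filter⁺ ramified? (Uniqueₚ.filter⁺ (hit (7 * m + 3)) pairs!)) lift lower to from divisor)))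
      (∑-~0 (filter (λ ab → ¬? (ramified? ab)) at-7m+3) unramified))
    (~-reflexive (trans (ℤₚ.+-identityʳ (∑ at-m divisor)) (sym (gf-coeff (pairs B) divisor quad m)))))

sgn² : ∀ k → sgn k *ᶻ sgn k ≡ 1ℤ
sgn² k = trans (sym (sgn-+ k k)) (trans (cong sgn (sym (twice-≡ k))) (sgn-twice k))

-- pod₋₃ as a coefficient of a cube

module _ (N : ℕ) where

  open Pods N

  private
    -- Parts up to 2(N+1) cover all partitions of N; the successor matches the form of `P-⊠-Ψ`.
    M = suc N
    E = pods M
    space : List Triple
    space = cartesianProduct E (cartesianProduct E E)

    size : Triple → ℕ
    size (xs , ys , zs) = sum xs + (sum ys + sum zs)

    sign : Triple → ℤ
    sign (xs , ys , zs) = sgn (sum xs) *ᶻ (sgn (sum ys) *ᶻ sgn (sum zs))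

    sized? : Decidable (λ t → size t ≡ N)
    sized? t = size t ℕₚ.≟ N

    sign-size : ∀ t → sign t ≡ sgn (size t)
    sign-size (xs , ys , zs) = sym (trans (sgn-+ (sum xs) (sum ys + sum zs))
      (cong (sgn (sum xs) *ᶻ_) (sgn-+ (sum ys) (sum zs))))

    N≤ : N ≤ twice M
    N≤ = ℕₚ.m≤n⇒m≤1+n (ℕₚ.m≤n⇒m≤1+n (subst (N ≤_) (sym (twice-≡ N)) (ℕₚ.m≤m+n N N)))

    parts≤sum : ∀ xs → All (_≤ sum xs) xs
    parts≤sum []       = []
    parts≤sum (x ∷ xs) = ℕₚ.m≤m+n x (sum xs) ∷ All.map (λ p → ℕₚ.≤-trans p (ℕₚ.m≤n+m (sum xs) x)) (parts≤sum xs)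

    ∈-E : ∀ {xs} → IsPod xs → sum xs ≤ N → xs ∈ E
    ∈-E {xs} pod s≤N = pods-complete M
      (pod , All.map (λ p → ℕₚ.≤-trans p (ℕₚ.≤-trans s≤N N≤)) (parts≤sum xs)) s≤N

    to : ∀ {t} → t ∈ filter sized? space → t ∈ podTriples N × t ≡ t
    to {t@(xs , ys , zs)} t∈ with ∈-filter⁻ sized? {xs = space} t∈
    ... | t∈space , s with ∈-cartesianProduct⁻ E (cartesianProduct E E) t∈space
    ... | xs∈ , yzs∈ with ∈-cartesianProduct⁻ E E yzs∈
    ... | ys∈ , zs∈ = Equivalence.from (podTriples-complete N t)
      (s , proj₁ (pods-sound M xs∈) , proj₁ (pods-sound M ys∈) , proj₁ (pods-sound M zs∈)) , refl

    from : ∀ {t} → t ∈ podTriples N → t ∈ filter sized? space × t ≡ t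
    from {t@(xs , ys , zs)} t∈ with Equivalence.to (podTriples-complete N t) t∈
    ... | s , px , py , pz = ∈-filter⁺ sized?
      (∈-cartesianProduct⁺ (∈-E px (le (ℕₚ.m≤m+n (sum xs) _)))
        (∈-cartesianProduct⁺
          (∈-E py (le (ℕₚ.≤-trans (ℕₚ.m≤m+n (sum ys) (sum zs)) (ℕₚ.m≤n+m _ (sum xs)))))
          (∈-E pz (le (ℕₚ.≤-trans (ℕₚ.m≤n+m (sum zs) (sum ys)) (ℕₚ.m≤n+m _ (sum xs))))))) s , refl
      where
      le : ∀ {k} → k ≤ size t → k ≤ N
      le k≤ = ℕₚ.≤-trans k≤ (ℕₚ.≤-reflexive s)

    E! : Unique E
    E! = pods-unique M

  -- The sign of a triple depends only on its total, which is N for every triple counted.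
  P³-coeff : (P M ⊠ (P M ⊠ P M)) N ≡ sgn N *ᶻ + pod₋₃ N
  P³-coeff = begin
    (P M ⊠ (P M ⊠ P M)) N
      ≡⟨ at (S.trans (S.*-congˡ {P M} (gf-⊠ E E (λ xs → sgn (sum xs)) (λ xs → sgn (sum xs)) sum sum))
                     (gf-⊠ E (cartesianProduct E E) (λ xs → sgn (sum xs))
                       (λ (ys , zs) → sgn (sum ys) *ᶻ sgn (sum zs)) sum (λ (ys , zs) → sum ys + sum zs))) N ⟩
    gf space sign size N
      ≡⟨ gf-coeff space sign size N ⟩
    ∑ (filter sized? space) sign
      ≡⟨ ∑-cong-∈ (filter sized? space) (λ {t} t∈ → trans (sign-size t)
           (trans (cong sgn (proj₂ (∈-filter⁻ sized? {xs = space} t∈))) (sym (ℤₚ.*-identityʳ (sgn N))))) ⟩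
    ∑ (filter sized? space) (λ _ → sgn N *ᶻ 1ℤ)
      ≡⟨ ∑-reindex (Uniqueₚ.filter⁺ sized? (Uniqueₚ.cartesianProduct⁺ E! (Uniqueₚ.cartesianProduct⁺ E! E!)))
           (podTriples-unique N) id id to from (λ _ → sgn N *ᶻ 1ℤ) ⟩
    ∑ (podTriples N) (λ _ → sgn N *ᶻ 1ℤ)
      ≡⟨ ∑-* (sgn N) (podTriples N) (λ _ → 1ℤ) ⟩
    sgn N *ᶻ ∑ (podTriples N) (λ _ → 1ℤ)
      ≡⟨ cong (sgn N *ᶻ_) (∑-1 (podTriples N)) ⟩
    sgn N *ᶻ + pod₋₃ N ∎
    where open ≡-Reasoning

-- Sums of three squares

odd² : ∀ k → odd k *ᶻ odd k ≡ + 8 *ᶻ + T k +ᶻ 1ℤ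
odd² k = begin
  odd k *ᶻ odd k                       ≡⟨ lemma₁ k ⟩
  + 4 *ᶻ (k *ᶻ (k +ᶻ 1ℤ)) +ᶻ 1ℤ        ≡⟨ cong (λ z → + 4 *ᶻ z +ᶻ 1ℤ) (sym (double-T k)) ⟩
  + 4 *ᶻ (+ 2 *ᶻ + T k) +ᶻ 1ℤ          ≡⟨ lemma₂ (+ T k) ⟩
  + 8 *ᶻ + T k +ᶻ 1ℤ                   ∎
  where
  open ≡-Reasoning
  lemma₁ : ∀ k → (+ 2 *ᶻ k +ᶻ 1ℤ) *ᶻ (+ 2 *ᶻ k +ᶻ 1ℤ) ≡ + 4 *ᶻ (k *ᶻ (k +ᶻ 1ℤ)) +ᶻ 1ℤ
  lemma₁ = solve-∀
  lemma₂ : ∀ t → + 4 *ᶻ (+ 2 *ᶻ t) +ᶻ 1ℤ ≡ + 8 *ᶻ t +ᶻ 1ℤ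
  lemma₂ = solve-∀

data Parity : ℤ → Set where
  even-of : ∀ k → Parity (+ 2 *ᶻ k)
  odd-of  : ∀ k → Parity (odd k)

parity-pos : ∀ n → Parity (+ n)
parity-pos zero    = even-of 0ℤ
parity-pos (suc n) = subst Parity (sym (ℤₚ.pos-+ 1 n)) (next (parity-pos n))
  where
  next : ∀ {x} → Parity x → Parity (1ℤ +ᶻ x)
  next (even-of k) = subst Parity (lemma k) (odd-of k)
    where
    lemma : ∀ k → + 2 *ᶻ k +ᶻ 1ℤ ≡ 1ℤ +ᶻ + 2 *ᶻ k
    lemma = solve-∀
  next (odd-of k) = subst Parity (lemma k) (even-of (k +ᶻ 1ℤ))
    where
    lemma : ∀ k → + 2 *ᶻ (k +ᶻ 1ℤ) ≡ 1ℤ +ᶻ (+ 2 *ᶻ k +ᶻ 1ℤ)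
    lemma = solve-∀

parity-neg : ∀ {x} → Parity x → Parity (- x)
parity-neg (even-of k) = subst Parity (lemma k) (even-of (- k))
  where
  lemma : ∀ k → + 2 *ᶻ - k ≡ - (+ 2 *ᶻ k)
  lemma = solve-∀
parity-neg (odd-of k) = subst Parity (lemma k) (odd-of (- k - 1ℤ))
  where
  lemma : ∀ k → + 2 *ᶻ (- k - 1ℤ) +ᶻ 1ℤ ≡ - (+ 2 *ᶻ k +ᶻ 1ℤ)
  lemma = solve-∀

parity : ∀ x → Parity x
parity (+ n)    = parity-pos n
parity -[1+ n ] = parity-neg (parity-pos (suc n))

half : ℤ → ℤ
half x with parity x
... | even-of k = k
... | odd-of k  = k

multiple⇒∣ : ∀ {d c} z → + d *ᶻ z ≡ + c → d ℕDiv.∣ c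
multiple⇒∣ {d} z eq = divides ∣ z ∣ (trans (cong ∣_∣ (sym eq)) (trans (ℤₚ.abs-* (+ d) z) (ℕₚ.*-comm d ∣ z ∣)))

half-odd : ∀ k → half (odd k) ≡ k
half-odd k = go (odd k) refl
  where
  -- x is kept general because a match on `parity (odd k)` would have to unify its index with both
  -- constructors' indices.
  go : ∀ x → x ≡ odd k → half x ≡ k
  go x eq with parity x
  ... | even-of j = contradiction (multiple⇒∣ (j - k) (trans (lemma j k) (trans (cong (_- + 2 *ᶻ k) eq) (lemma′ k)))) (from-no (2 ∣? 1))
    where
    lemma : ∀ j k → + 2 *ᶻ (j - k) ≡ + 2 *ᶻ j - + 2 *ᶻ k
    lemma = solve-∀
    lemma′ : ∀ k → + 2 *ᶻ k +ᶻ 1ℤ - + 2 *ᶻ k ≡ 1ℤ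
    lemma′ = solve-∀
  ... | odd-of j = ℤₚ.*-cancelˡ-≡ (+ 2) j k (∙-cancelʳ 1ℤ (+ 2 *ᶻ j) (+ 2 *ᶻ k) eq)

-- Phrased through `half`, since it serves to show that `halves` inverts `odds`.
OddInteger : ℤ → Set
OddInteger x = odd (half x) ≡ x

data SquareMod4 (x : ℤ) : Set where
  residue-0 : ∀ s → x *ᶻ x ≡ + 4 *ᶻ s +ᶻ 0ℤ → SquareMod4 x
  residue-1 : ∀ s → x *ᶻ x ≡ + 4 *ᶻ s +ᶻ 1ℤ → OddInteger x → SquareMod4 x

squareMod4 : ∀ x → SquareMod4 x
squareMod4 x with parity x
... | even-of k = residue-0 (k *ᶻ k) (lemma k)
  where
  lemma : ∀ k → + 2 *ᶻ k *ᶻ (+ 2 *ᶻ k) ≡ + 4 *ᶻ (k *ᶻ k) +ᶻ 0ℤ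
  lemma = solve-∀
... | odd-of k = residue-1 (k *ᶻ (k +ᶻ 1ℤ)) (lemma k) (cong odd (half-odd k))
  where
  lemma : ∀ k → (+ 2 *ᶻ k +ᶻ 1ℤ) *ᶻ (+ 2 *ᶻ k +ᶻ 1ℤ) ≡ + 4 *ᶻ (k *ᶻ (k +ᶻ 1ℤ)) +ᶻ 1ℤ
  lemma = solve-∀

pos-8n+3 : ∀ n → + (8 * n + 3) ≡ + 8 *ᶻ + n +ᶻ + 3
pos-8n+3 n = trans (ℤₚ.pos-+ (8 * n) 3) (cong (_+ᶻ + 3) (ℤₚ.pos-* 8 n))

-- Modulo 4 a sum of squares counts its odd terms, and the total is 3 modulo 4; with fewer than
-- three odd terms, 4 would divide 1, 2 or 3.
three-odd-squares : ∀ n x y z → x *ᶻ x +ᶻ (y *ᶻ y +ᶻ (z *ᶻ z +ᶻ 0ℤ)) ≡ + (8 * n + 3) →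
                    OddInteger x × OddInteger y × OddInteger z
three-odd-squares n x y z eq = go (squareMod4 x) (squareMod4 y) (squareMod4 z)
  where
  residue : ∀ a b c s t u → x *ᶻ x ≡ + 4 *ᶻ s +ᶻ a → y *ᶻ y ≡ + 4 *ᶻ t +ᶻ b → z *ᶻ z ≡ + 4 *ᶻ u +ᶻ c →
            + 4 *ᶻ (s +ᶻ t +ᶻ u - + 2 *ᶻ + n) ≡ + 3 - (a +ᶻ (b +ᶻ c))
  residue a b c s t u p q r = begin
    + 4 *ᶻ (s +ᶻ t +ᶻ u - + 2 *ᶻ + n)
      ≡⟨ lemma₁ a b c s t u (+ n) ⟩
    (+ 4 *ᶻ s +ᶻ a) +ᶻ ((+ 4 *ᶻ t +ᶻ b) +ᶻ ((+ 4 *ᶻ u +ᶻ c) +ᶻ 0ℤ)) - (+ 8 *ᶻ + n +ᶻ + 3) +ᶻ (+ 3 - (a +ᶻ (b +ᶻ c)))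
      ≡⟨ cong₂ (λ l m → l - m +ᶻ (+ 3 - (a +ᶻ (b +ᶻ c))))
           (trans (sym (cong₂ _+ᶻ_ p (cong₂ _+ᶻ_ q (cong (_+ᶻ 0ℤ) r)))) eq) (sym (pos-8n+3 n)) ⟩
    + (8 * n + 3) - + (8 * n + 3) +ᶻ (+ 3 - (a +ᶻ (b +ᶻ c)))
      ≡⟨ lemma₂ (+ (8 * n + 3)) (+ 3 - (a +ᶻ (b +ᶻ c))) ⟩
    + 3 - (a +ᶻ (b +ᶻ c)) ∎
    where
    open ≡-Reasoning
    lemma₁ : ∀ a b c s t u n → + 4 *ᶻ (s +ᶻ t +ᶻ u - + 2 *ᶻ n) ≡
      (+ 4 *ᶻ s +ᶻ a) +ᶻ ((+ 4 *ᶻ t +ᶻ b) +ᶻ ((+ 4 *ᶻ u +ᶻ c) +ᶻ 0ℤ)) - (+ 8 *ᶻ n +ᶻ + 3) +ᶻ (+ 3 - (a +ᶻ (b +ᶻ c)))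
    lemma₁ = solve-∀
    lemma₂ : ∀ m r → m - m +ᶻ r ≡ r
    lemma₂ = solve-∀
  4∤1 = from-no (4 ∣? 1)
  4∤2 = from-no (4 ∣? 2)
  4∤3 = from-no (4 ∣? 3)
  go : SquareMod4 x → SquareMod4 y → SquareMod4 z → OddInteger x × OddInteger y × OddInteger z
  go (residue-1 _ _ ox) (residue-1 _ _ oy) (residue-1 _ _ oz) = ox , oy , oz
  go (residue-0 s p)   (residue-0 t q)   (residue-0 u r)   = contradiction (multiple⇒∣ _ (residue 0ℤ 0ℤ 0ℤ s t u p q r)) 4∤3
  go (residue-0 s p)   (residue-0 t q)   (residue-1 u r _) = contradiction (multiple⇒∣ _ (residue 0ℤ 0ℤ 1ℤ s t u p q r)) 4∤2
  go (residue-0 s p)   (residue-1 t q _) (residue-0 u r)   = contradiction (multiple⇒∣ _ (residue 0ℤ 1ℤ 0ℤ s t u p q r)) 4∤2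
  go (residue-0 s p)   (residue-1 t q _) (residue-1 u r _) = contradiction (multiple⇒∣ _ (residue 0ℤ 1ℤ 1ℤ s t u p q r)) 4∤1
  go (residue-1 s p _) (residue-0 t q)   (residue-0 u r)   = contradiction (multiple⇒∣ _ (residue 1ℤ 0ℤ 0ℤ s t u p q r)) 4∤2
  go (residue-1 s p _) (residue-0 t q)   (residue-1 u r _) = contradiction (multiple⇒∣ _ (residue 1ℤ 0ℤ 1ℤ s t u p q r)) 4∤1
  go (residue-1 s p _) (residue-1 t q _) (residue-0 u r)   = contradiction (multiple⇒∣ _ (residue 1ℤ 1ℤ 0ℤ s t u p q r)) 4∤1

module _ {n B : ℕ} (n<B : n < B) where

  private
    indices : List (ℤ × ℤ × ℤ)
    indices = cartesianProduct (ints B) (cartesianProduct (ints B) (ints B))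

    total : ℤ × ℤ × ℤ → ℕ
    total (k , l , m) = T k + (T l + T m)

    total? : Decidable (λ t → total t ≡ n)
    total? t = total t ℕₚ.≟ n

    odds : ℤ × ℤ × ℤ → Vec ℤ 3
    odds (k , l , m) = odd k ∷ odd l ∷ odd m ∷ []

    halves : Vec ℤ 3 → ℤ × ℤ × ℤ
    halves (x ∷ y ∷ z ∷ []) = half x , half y , half z

    sum-odds : ∀ t → sumOfSquares (odds t) ≡ + (8 * total t + 3)
    sum-odds t@(k , l , m) = begin
      odd k *ᶻ odd k +ᶻ (odd l *ᶻ odd l +ᶻ (odd m *ᶻ odd m +ᶻ 0ℤ))
        ≡⟨ cong₂ _+ᶻ_ (odd² k) (cong₂ _+ᶻ_ (odd² l) (cong (_+ᶻ 0ℤ) (odd² m))) ⟩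
      + 8 *ᶻ + T k +ᶻ 1ℤ +ᶻ (+ 8 *ᶻ + T l +ᶻ 1ℤ +ᶻ (+ 8 *ᶻ + T m +ᶻ 1ℤ +ᶻ 0ℤ))
        ≡⟨ lemma (+ T k) (+ T l) (+ T m) ⟩
      + 8 *ᶻ (+ T k +ᶻ (+ T l +ᶻ + T m)) +ᶻ + 3
        ≡⟨ cong (λ j → + 8 *ᶻ j +ᶻ + 3) (sym (trans (ℤₚ.pos-+ (T k) (T l + T m)) (cong (+ T k +ᶻ_) (ℤₚ.pos-+ (T l) (T m))))) ⟩
      + 8 *ᶻ + total t +ᶻ + 3
        ≡⟨ sym (pos-8n+3 (total t)) ⟩
      + (8 * total t + 3) ∎
      where
      open ≡-Reasoning
      lemma : ∀ a b c → + 8 *ᶻ a +ᶻ 1ℤ +ᶻ (+ 8 *ᶻ b +ᶻ 1ℤ +ᶻ (+ 8 *ᶻ c +ᶻ 1ℤ +ᶻ 0ℤ)) ≡ + 8 *ᶻ (a +ᶻ (b +ᶻ c)) +ᶻ + 3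
      lemma = solve-∀

    halves-odds : ∀ t → halves (odds t) ≡ t
    halves-odds (k , l , m) = cong₂ _,_ (half-odd k) (cong₂ _,_ (half-odd l) (half-odd m))

    to : ∀ {t} → t ∈ filter total? indices → odds t ∈ representations 3 (8 * n + 3) × halves (odds t) ≡ t
    to {t} t∈ = Equivalence.from (representations-complete 3 (8 * n + 3) (odds t))
      (trans (sum-odds t) (cong (λ j → + (8 * j + 3)) (proj₂ (∈-filter⁻ total? {xs = indices} t∈)))) , halves-odds t

    from : ∀ {v} → v ∈ representations 3 (8 * n + 3) → halves v ∈ filter total? indices × odds (halves v) ≡ v
    from {v@(x ∷ y ∷ z ∷ [])} v∈ with Equivalence.to (representations-complete 3 (8 * n + 3) v) v∈
    ... | eq with three-odd-squares n x y z eq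
    ... | ox , oy , oz = ∈-filter⁺ total?
      (∈-cartesianProduct⁺ (∈-ints (half x) (bounded (ℕₚ.m≤m+n (T (half x)) _)))
        (∈-cartesianProduct⁺
          (∈-ints (half y) (bounded (ℕₚ.≤-trans (ℕₚ.m≤m+n (T (half y)) (T (half z))) (ℕₚ.m≤n+m _ (T (half x))))))
          (∈-ints (half z) (bounded (ℕₚ.≤-trans (ℕₚ.m≤n+m (T (half z)) (T (half y))) (ℕₚ.m≤n+m _ (T (half x))))))))
      total≡n , v≡
      where
      v≡ : odds (halves v) ≡ v
      v≡ rewrite ox | oy | oz = refl
      total≡n : total (halves v) ≡ n
      total≡n = ℕₚ.*-cancelˡ-≡ (total (halves v)) n 8 (ℕₚ.+-cancelʳ-≡ 3 _ _ (ℤₚ.+-injective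
        (trans (sym (sum-odds (halves v))) (trans (cong sumOfSquares v≡) eq))))
      bounded : ∀ {j} → j ≤ total (halves v) → j < B
      bounded j≤ = ℕₚ.≤-<-trans (subst (_ ≤_) total≡n j≤) n<B

    indices! : Unique indices
    indices! = Uniqueₚ.cartesianProduct⁺ (ints-unique B) (Uniqueₚ.cartesianProduct⁺ (ints-unique B) (ints-unique B))

  -- By (2k+1)² = 8 `T k` + 1, the representations correspond to triples k, l, m with T k + T l + T
  -- m = n; each coordinate contributes a factor 2 for its sign.
  r₃-coeff : + r 3 (8 * n + 3) ≡ + 8 *ᶻ (Ψ B ^ˢ 3) n
  r₃-coeff = begin
    + r 3 (8 * n + 3)
      ≡⟨ sym (∑-1 (representations 3 (8 * n + 3))) ⟩
    ∑ (representations 3 (8 * n + 3)) (λ _ → 1ℤ)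
      ≡⟨ sym (∑-reindex (Uniqueₚ.filter⁺ total? indices!) (representations-unique 3 (8 * n + 3)) odds halves to from (λ _ → 1ℤ)) ⟩
    ∑ (filter total? indices) (λ _ → 1ℤ)
      ≡⟨ sym (gf-coeff indices (λ _ → 1ℤ) total n) ⟩
    gf indices (λ _ → 1ℤ) total n
      ≡⟨ sym (at (S.trans (S.*-congˡ {Ψℤ} (gf-⊠ (ints B) (ints B) (λ _ → 1ℤ) (λ _ → 1ℤ) T T))
           (gf-⊠ (ints B) (cartesianProduct (ints B) (ints B)) (λ _ → 1ℤ) (λ _ → 1ℤ) T (λ (l , m) → T l + T m))) n) ⟩
    (Ψℤ ⊠ (Ψℤ ⊠ Ψℤ)) n
      ≡⟨ at (S.*-cong (Ψ-ints B) (S.*-cong (Ψ-ints B) (Ψ-ints B))) n ⟩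
    ((const (+ 2) ⊠ Ψ B) ⊠ ((const (+ 2) ⊠ Ψ B) ⊠ (const (+ 2) ⊠ Ψ B))) n
      ≡⟨ at (solve 1 (λ y → (con (+ 2) :* y) :* ((con (+ 2) :* y) :* (con (+ 2) :* y)) :=
                            con (+ 8) :* (y :* (y :* (y :* con 1ℤ)))) S.refl (Ψ B)) n ⟩
    (const (+ 8) ⊠ Ψ B ^ˢ 3) n
      ≡⟨ const-⊠ (+ 8) (Ψ B ^ˢ 3) n ⟩
    + 8 *ᶻ (Ψ B ^ˢ 3) n ∎
    where
    open ≡-Reasoning
    Ψℤ : Series
    Ψℤ = gf (ints B) (λ _ → 1ℤ) T

-- Reducing 1/Ψ³ = Ψ⁴/Ψ⁷ modulo 7

module _ (n : ℕ) where

  private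
    N K : ℕ
    N = 7 * n + 3
    K = twice (suc N)

    N<K : N < K
    N<K = s≤s (ℕₚ.m≤n⇒m≤1+n (subst (N ≤_) (sym (twice-≡ N)) (ℕₚ.m≤m+n N N)))

    n≤N : n ≤ N
    n≤N = ℕₚ.≤-trans (ℕₚ.m≤n*m n 7) (ℕₚ.m≤m+n (7 * n) 3)

    module Exact = Truncation 0ℤ N
    module Mod7  = Truncation (+ 7) N
    module Mod7ₙ = Truncation (+ 7) n
    -- K computes to the successor of `suc (twice N)`, so `Ψ (suc B)` and `F (suc B)` there are Y
    -- and G here.
    open FourthPower N (suc (twice N)) (ℕₚ.≤-pred N<K) using (~⇒≡; F-≋-Ψ⁴)

    exact⇒mod7 : ∀ {f g} → f Exact.≋ g → f Mod7.≋ g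
    exact⇒mod7 p = Mod7.upTo-N λ i i≤N → ~-reflexive (~⇒≡ (Exact.coeff p i i≤N))

    exact⇒mod7ₙ : ∀ {f g} → f Exact.≋ g → f Mod7ₙ.≋ g
    exact⇒mod7ₙ p = Mod7ₙ.upTo-N λ i i≤n → ~-reflexive (~⇒≡ (Exact.coeff p i (ℕₚ.≤-trans i≤n n≤N)))

    Y Y₇ G P P³ : Series
    Y  = Ψ K
    Y₇ = gf (upTo K) (λ _ → 1ℤ) (λ k → 7 * tri k)
    G  = F K
    P  = Pods.P N (suc N)
    P³ = P ⊠ (P ⊠ P)

    PY : P ⊠ Y Exact.≋ const 1ℤ
    PY = Gauss.P-⊠-Ψ N N N<K

    G-≋-Y⁴ : G Exact.≋ Y ^ˢ 4
    G-≋-Y⁴ = F-≋-Ψ⁴ P PY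

    one : Series
    one = const 1ℤ

    P³Y⁷ : P³ ⊠ Y ^ˢ 7 Exact.≋ G
    P³Y⁷ = begin
      P³ ⊠ Y ^ˢ 7
        ≈⟨ ≈⇒≋ (solve 2 (λ p y → (p :* (p :* p)) :* y :^ 7 := (p :* y) :* ((p :* y) :* ((p :* y) :* y :^ 4)))
             S.refl P Y) ⟩
      (P ⊠ Y) ⊠ ((P ⊠ Y) ⊠ ((P ⊠ Y) ⊠ Y ^ˢ 4))
        ≈⟨ ⊠-cong PY (⊠-cong PY (⊠-cong PY (≋-sym G-≋-Y⁴))) ⟩
      one ⊠ (one ⊠ (one ⊠ G))
        ≈⟨ ≈⇒≋ (solve 1 (λ g → con 1ℤ :* (con 1ℤ :* (con 1ℤ :* g)) := g) S.refl G) ⟩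
      G ∎
      where
      open Exact
      open SetoidReasoning ≋-setoid

    P³Y₇ : P³ ⊠ Y₇ Mod7.≋ G
    P³Y₇ = ≋-trans (⊠-congˡ P³ (≋-sym (frobenius N (upTo K) tri))) (exact⇒mod7 P³Y⁷)
      where open Mod7

    -- Extraction turns the precision N = 7n+3 into the precision n, because m ≤ n gives 7m+3 ≤ N.
    UP³Y : U P³ ⊠ Y Mod7ₙ.≋ G
    UP³Y = Mod7ₙ.upTo-N λ m m≤n →
      let 7m+3≤N = ℕₚ.+-monoˡ-≤ 3 (ℕₚ.*-monoʳ-≤ 7 m≤n) in
      ~-trans (~-reflexive (sym (at (U-gf (upTo K) tri P³) m)))
        (~-trans (Mod7.coeff P³Y₇ (7 * m + 3) 7m+3≤N) (F-7m+3 {m = m} (ℕₚ.≤-<-trans 7m+3≤N N<K)))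

    -- P cancels one Y on each side of U P³ · Y ≡ Y⁴.
    UP³ : U P³ Mod7ₙ.≋ Y ^ˢ 3
    UP³ = begin
      U P³              ≈⟨ ≈⇒≋ (S.sym (S.*-identityʳ (U P³))) ⟩
      U P³ ⊠ one        ≈⟨ ⊠-congˡ (U P³) (≋-sym (exact⇒mod7ₙ PY)) ⟩
      U P³ ⊠ (P ⊠ Y)    ≈⟨ ≈⇒≋ (solve 3 (λ u p y → u :* (p :* y) := p :* (u :* y)) S.refl (U P³) P Y) ⟩
      P ⊠ (U P³ ⊠ Y)    ≈⟨ ⊠-congˡ P (≋-trans UP³Y (exact⇒mod7ₙ G-≋-Y⁴)) ⟩
      P ⊠ Y ^ˢ 4        ≈⟨ ≈⇒≋ (S.sym (S.*-assoc P Y (Y ^ˢ 3))) ⟩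
      (P ⊠ Y) ⊠ Y ^ˢ 3  ≈⟨ ⊠-congʳ (Y ^ˢ 3) (exact⇒mod7ₙ PY) ⟩
      one ⊠ Y ^ˢ 3      ≈⟨ ≈⇒≋ (S.*-identityˡ (Y ^ˢ 3)) ⟩
      Y ^ˢ 3            ∎
      where
      open Mod7ₙ
      open SetoidReasoning ≋-setoid

    signed-pod : sgn N *ᶻ + pod₋₃ N ~ + r 3 (8 * n + 3)
    signed-pod = ~-trans (~-reflexive (sym (P³-coeff N)))
      (~-trans (Mod7ₙ.coeff UP³ n ℕₚ.≤-refl)
        -- Since 8 ≡ 1 modulo 7, y differs from 8y by 7 times -y.
        (- (Y ^ˢ 3) n , trans (lemma ((Y ^ˢ 3) n))
          (cong (_+ᶻ + 7 *ᶻ - (Y ^ˢ 3) n) (sym (r₃-coeff (ℕₚ.≤-<-trans n≤N N<K))))))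
      where
      lemma : ∀ y → y ≡ + 8 *ᶻ y +ᶻ + 7 *ᶻ - y
      lemma = solve-∀

    -- 7n+3 = (n+1) + 2(3n+1).
    sgn-N : sgn N ≡ sgn (n + 1)
    sgn-N = begin
      sgn N                                ≡⟨ cong sgn (trans (lemma n) (cong (λ k → n + 1 + k) (sym (twice-≡ (3 * n + 1))))) ⟩
      sgn (n + 1 + twice (3 * n + 1))      ≡⟨ sgn-+ (n + 1) (twice (3 * n + 1)) ⟩
      sgn (n + 1) *ᶻ sgn (twice (3 * n + 1)) ≡⟨ cong (sgn (n + 1) *ᶻ_) (sgn-twice (3 * n + 1)) ⟩
      sgn (n + 1) *ᶻ 1ℤ                    ≡⟨ ℤₚ.*-identityʳ (sgn (n + 1)) ⟩
      sgn (n + 1)                          ∎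
      where
      open ≡-Reasoning
      lemma : ∀ n → 7 * n + 3 ≡ n + 1 + (3 * n + 1 + (3 * n + 1))
      lemma = solveℕ-∀

  pod-congruence : + pod₋₃ N ~ sgn (n + 1) *ᶻ + r 3 (8 * n + 3)
  pod-congruence = ~-trans (~-reflexive cancel-sign)
    (~-trans (*-cong (~-refl {sgn N}) signed-pod)
      (~-reflexive (cong (_*ᶻ + r 3 (8 * n + 3)) sgn-N)))
    where
    cancel-sign : + pod₋₃ N ≡ sgn N *ᶻ (sgn N *ᶻ + pod₋₃ N)
    cancel-sign = begin
      + pod₋₃ N                       ≡⟨ sym (ℤₚ.*-identityˡ (+ pod₋₃ N)) ⟩
      1ℤ *ᶻ + pod₋₃ N                 ≡⟨ cong (_*ᶻ + pod₋₃ N) (sym (sgn² N)) ⟩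
      sgn N *ᶻ sgn N *ᶻ + pod₋₃ N     ≡⟨ ℤₚ.*-assoc (sgn N) (sgn N) (+ pod₋₃ N) ⟩
      sgn N *ᶻ (sgn N *ᶻ + pod₋₃ N)   ∎
      where open ≡-Reasoning

~⇒∣ : ∀ {a b} → a ~ b → (+ 7) ∣ (a - b)
~⇒∣ {b = b} (q , refl) = divides ∣ q ∣ (begin
  ∣ b +ᶻ + 7 *ᶻ q - b ∣ ≡⟨ cong ∣_∣ (lemma b (+ 7 *ᶻ q)) ⟩
  ∣ + 7 *ᶻ q ∣          ≡⟨ ℤₚ.abs-* (+ 7) q ⟩
  7 * ∣ q ∣             ≡⟨ ℕₚ.*-comm 7 ∣ q ∣ ⟩
  ∣ q ∣ * 7             ∎)
  where
  open ≡-Reasoning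
  lemma : ∀ b x → b +ᶻ x - b ≡ x
  lemma = solve-∀

theorem4p1 : ∀ (n : ℕ) →
    (+ 7) ∣ ((+ pod₋₃ (7 * n + 3)) - (-1ℤ ^ (n + 1)) *ᶻ (+ r 3 (8 * n + 3)))
theorem4p1 n = ~⇒∣ (pod-congruence n)
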